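{- Let $\mathbb B$ be a complete Boolean algebra and $U$ an ultrafilter on $\mathbb B$ (the Boolean ultrapower by $U$ may be ill-founded), and suppose there is a skeleton $\mathfrak A$ for $(\mathbb B,U)$. Then \[\bigcap_{A\in\mathfrak A}\{x\subseteq\check{\mathrm V}_U\mid\pi_{A,\infty}^{ -1}[x]\in(M_A)^c\}\subseteq\{x\subseteq\check{\mathrm V}_U\mid x\in(\mathrm V^{\mathbb B}/U)^c\}.\] The converse of this inclusion holds if and only if $\mathfrak A$ is simple. Moreover, if every maximal antichain of $\mathbb B$ is simple, then \[\bigcap_{A}\{x\subseteq\check{\mathrm V}_U\mid\pi_{A,\infty}^{ -1}[x]\in(M_A)^c\}=\{x\subseteq\check{\mathrm V}_U\mid x\in(\mathrm V^{\mathbb B}/U)^c\},\] where $A$ ranges over all maximal antichains of $\mathbb B$.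
   Context: Let $U\in\mathrm V$ be an ultrafilter on $\mathbb B$. $\mathrm V^{\mathbb B}/U$ consists of the classes $[\sigma]_U$ of $\mathbb B$-names under $\sigma\sim\tau$ iff $[\![\sigma=\tau]\!]\in U$, with $[\sigma]_U\,E\,[\tau]_U$ iff $[\![\sigma\in\tau]\!]\in U$. The Boolean ultrapower $\check{\mathrm V}_U\subseteq\mathrm V^{\mathbb B}/U$ consists of the classes of names with $[\![\sigma\in\check{\mathrm V}]\!]=\bigvee_{x\in\mathrm V}[\![\sigma=\check x]\!]\in U$, and $j:\mathrm V\to\check{\mathrm V}_U$, $j(x)=[\check x]_U$. $\dot G$ is the canonical name for the generic filter. If $M=\langle|M|,\in^M\rangle$ is a (possibly ill-founded) model of set theory and $a\in|M|$, let $a^c=\{b\in|M|\mid M\models b\in a\}$ be the set coded by $a$, and $M^c=\{a^c\mid a\in|M|\}$; a set is coded in $M$ if it belongs to $M^c$. For a maximal antichain $A\subseteq\mathbb B$ (of nonzero elements), $U_A=\{X\subseteq A\mid\bigvee X\in U\}$, and $M_A$ is the (possibly ill-founded) ultrapower of $\mathrm V$ by $U_A$. $B\le^*A$ ($B$ refines $A$) means every $b\in B$ is below some $a\in A$. The direct limit map $\pi_{A,\infty}:M_A\to\check{\mathrm V}_U$ is given by $\pi_{A,\infty}([f]_{U_A})=[\tau]_U$, where $\tau$ is a name mixing the names $(f(a))\check{}$, i.e. $a\le[\![\tau=(f(a))\check{}\,]\!]$ for all $a\in A$. Equivalently, $\pi_{A,\infty}([f]_{U_A})$ is $j(f)(b_A)$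 as computed in $\check{\mathrm V}_U$, where $b_A$ is the unique element common to $j(A)$ and $[\dot G]_U$ in the sense of $\mathrm V^{\mathbb B}/U$. The antichain $A$ is simple if $G_A:=\pi_{A,\infty}^{ -1}\big[([\dot G]_U)^c\big]$ is coded in $M_A$. A skeleton for $(\mathbb B,U)$ is a set $\mathfrak A$ of maximal antichains of $\mathbb B$ such that (1) $\mathfrak A$ is directed under refinement (any two members have a common refinement in $\mathfrak A$), (2) $j[\mathfrak A]=\{j(A)\mid A\in\mathfrak A\}$ is coded in $\mathrm V^{\mathbb B}/U$, and (3) every element of $\check{\mathrm V}_U$ is of the form $j(f)(b_A)$ for some $A\in\mathfrak A$ and $f:A\to\mathrm V$. It is simple if every $A\in\mathfrak A$ is simple. -}

module Defs where

open import Level using (Level; Lift; lift; _⊔_) renaming (suc to lsuc)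
open import Data.Bool using (Bool; if_then_else_)
open import Data.Product using (Σ; ∃; ∃-syntax; _×_; _,_; proj₁; proj₂)
open import Data.Sum using (_⊎_)
open import Function using (id; _∘_; _on_)
open import Function.Bundles using (_⇔_)
open import Relation.Binary using (Rel)
open import Relation.Binary.Lattice.Structures using (IsBooleanAlgebra)
open import Relation.Nullary using (¬_)
open import Relation.Unary using (Pred; _∈_; _∉_; _⊆_)

private
  variable
    ℓ a e k p : Level

-- V is Aczel's type of iterative sets.  With excluded middle for all types
-- (which, Σ being the existential quantifier, also gives choice) and function
-- extensionality it is a model of ZFC; the theorem assumes both.  A type in
-- Set ℓ plays the role of a set, so that "F : I → X with I : Set ℓ" is a
-- set-indexed family, and a predicate or function on V is a class.

data V (ℓ : Level) : Set (lsuc ℓ) where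
  sup : (I : Set ℓ) → (I → V ℓ) → V ℓ

Index : V ℓ → Set ℓ
Index (sup I _) = I

element : (x : V ℓ) → Index x → V ℓ
element (sup _ f) = f

infix 4 _≈ⱽ_ _∈ⱽ_

_≈ⱽ_ : V ℓ → V ℓ → Set ℓ
sup I f ≈ⱽ sup J g = (∀ i → ∃[ j ] f i ≈ⱽ g j) × (∀ j → ∃[ i ] f i ≈ⱽ g j)

_∈ⱽ_ : V ℓ → V ℓ → Set ℓ
x ∈ⱽ y = ∃[ j ] x ≈ⱽ element y j

｛_,_｝ : V ℓ → V ℓ → V ℓ
｛_,_｝ {ℓ} x y = sup (Lift ℓ Bool) λ { (lift b) → if b then x else y }

⟨_,_⟩ : V ℓ → V ℓ → V ℓ
⟨ x , y ⟩ = ｛ ｛ x , x ｝ , ｛ x , y ｝ ｝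

-- A possibly ill-founded model.  Quotients are presented by representatives:
-- _≈ᴹ_ is the equality of the quotient.

record ∈-Structure (a e : Level) : Set (lsuc (a ⊔ e)) where
  infix 4 _≈ᴹ_ _∈ᴹ_
  field
    ∣M∣  : Set a
    _≈ᴹ_ : Rel ∣M∣ e
    _∈ᴹ_ : Rel ∣M∣ e

module _ (M : ∈-Structure a e) where
  open ∈-Structure M

  Coded : Pred ∣M∣ p → Set _
  Coded X = ∃[ c ] ∀ b → X b ⇔ b ∈ᴹ c

  -- M ⊨ z = {u, v}
  IsUnorderedPair : (z u v : ∣M∣) → Set _
  IsUnorderedPair z u v = ∀ w → w ∈ᴹ z ⇔ (w ≈ᴹ u ⊎ w ≈ᴹ v)

  -- M ⊨ z = (u, v)
  IsOrderedPair : (z u v : ∣M∣) → Set _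
  IsOrderedPair z u v =
    ∃[ s ] ∃[ t ] IsUnorderedPair s u u × IsUnorderedPair t u v
                × IsUnorderedPair z s t

module _ {A : Set a} (_≤_ : Rel A e) where

  -- K may be larger than A: suprema of subclasses of A are needed below.
  IsSup : {K : Set k} → (K → A) → A → Set _
  IsSup F b = (∀ k → F k ≤ b) × (∀ c → (∀ k → F k ≤ c) → b ≤ c)

  IsInf : {K : Set k} → (K → A) → A → Set _
  IsInf F b = (∀ k → b ≤ F k) × (∀ c → (∀ k → c ≤ F k) → c ≤ b)

-- The underlying set is an element of V, so that its members, its subsets and
-- the canonical name for the generic filter are available.  A member may be
-- indexed repeatedly, hence _≈_ rather than _≡_.

record CompleteBooleanAlgebra (ℓ : Level) : Set (lsuc ℓ) where
  field
    underlying : V ℓ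

  Carrier : Set ℓ
  Carrier = Index underlying

  infix  4 _≈_ _≤_
  infixr 6 _∨_
  infixr 7 _∧_
  infix  8 ∁_

  _≈_ : Rel Carrier ℓ
  _≈_ = _≈ⱽ_ on element underlying

  field
    _≤_              : Rel Carrier ℓ
    _∨_ _∧_          : Carrier → Carrier → Carrier
    ∁_               : Carrier → Carrier
    ⊤ ⊥              : Carrier
    isBooleanAlgebra : IsBooleanAlgebra _≈_ _≤_ _∨_ _∧_ ∁_ ⊤ ⊥
    ⋁ ⋀              : {I : Set ℓ} → (I → Carrier) → Carrier
    ⋁-isSup          : {I : Set ℓ} (F : I → Carrier) → IsSup _≤_ F (⋁ F)
    ⋀-isInf          : {I : Set ℓ} (F : I → Carrier) → IsInf _≤_ F (⋀ F)

  open IsBooleanAlgebra isBooleanAlgebra public using (_⇨_)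

module _ (𝔹 : CompleteBooleanAlgebra ℓ) where
  open CompleteBooleanAlgebra 𝔹

  record Ultrafilter : Set (lsuc ℓ) where
    field
      member    : Pred Carrier ℓ
      ⊤-member  : ⊤ ∈ member
      ⊥-∉       : ⊥ ∉ member
      upward    : ∀ {b c} → b ≤ c → b ∈ member → c ∈ member
      ∧-closed  : ∀ {b c} → b ∈ member → c ∈ member → b ∧ c ∈ member
      ultra     : ∀ b → b ∈ member ⊎ ∁ b ∈ member

  record IsAntichain (A : Pred Carrier ℓ) : Set ℓ where
    field
      resp         : ∀ {b c} → b ≈ c → b ∈ A → c ∈ A
      nonzero      : ∀ {b} → b ∈ A → ¬ b ≈ ⊥
      incompatible : ∀ {b c} → b ∈ A → c ∈ A → ¬ b ≈ c → b ∧ c ≈ ⊥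

  record MaximalAntichain : Set (lsuc ℓ) where
    field
      member      : Pred Carrier ℓ
      isAntichain : IsAntichain member
      maximal     : ∀ (A : Pred Carrier ℓ) → IsAntichain A →
                    member ⊆ A → A ⊆ member

    Elem : Set ℓ
    Elem = Σ Carrier member

    asSet : V ℓ
    asSet = sup Elem (element underlying ∘ proj₁)

  open MaximalAntichain

  infix 4 _≤*_

  _≤*_ : Rel MaximalAntichain ℓ
  B ≤* A = ∀ (b : Elem B) → ∃[ a ] proj₁ b ≤ proj₁ {B = member A} a

  -- Functions f : A → V; by replacement each of them is an element of V.
  record FunctionOn (A : MaximalAntichain) : Set (lsuc ℓ) where
    field
      app  : Elem A → V ℓ
      cong : ∀ {b c} → proj₁ b ≈ proj₁ c → app b ≈ⱽ app c

    graph : V ℓ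
    graph = sup (Elem A) λ b → ⟨ element underlying (proj₁ b) , app b ⟩

  open FunctionOn

  -- name I τ b is the set of pairs {(τ i, b i) | i ∈ I}.
  data Name : Set (lsuc ℓ) where
    name : (I : Set ℓ) → (I → Name) → (I → Carrier) → Name

  ⟦_＝_⟧ : Name → Name → Carrier
  ⟦ name I σ b ＝ name J τ c ⟧ =
    ⋀ (λ i → b i ⇨ ⋁ (λ j → c j ∧ ⟦ σ i ＝ τ j ⟧)) ∧
    ⋀ (λ j → c j ⇨ ⋁ (λ i → b i ∧ ⟦ σ i ＝ τ j ⟧))

  ⟦_∈_⟧ : Name → Name → Carrier
  ⟦ σ ∈ name J τ c ⟧ = ⋁ (λ j → c j ∧ ⟦ σ ＝ τ j ⟧)

  check : V ℓ → Name
  check (sup I f) = name I (check ∘ f) (λ _ → ⊤)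

  Ġ : Name
  Ġ = name Carrier (check ∘ element underlying) id

  Mixes : (A : MaximalAntichain) → FunctionOn A → Name → Set ℓ
  Mixes A f τ = ∀ a → proj₁ a ≤ ⟦ τ ＝ check (app f a) ⟧

  module _ (U : Ultrafilter) where
    private module U = Ultrafilter U

    Vᴮ/U : ∈-Structure (lsuc ℓ) ℓ
    Vᴮ/U = record
      { ∣M∣  = Name
      ; _≈ᴹ_ = λ σ τ → ⟦ σ ＝ τ ⟧ ∈ U.member
      ; _∈ᴹ_ = λ σ τ → ⟦ σ ∈ τ ⟧ ∈ U.member
      }

    open ∈-Structure Vᴮ/U renaming (_≈ᴹ_ to _~_; _∈ᴹ_ to _E_) using ()

    -- ⟦σ ∈ V̌⟧ ∈ U.  The join of ⟦σ = x̌⟧ over all x ∈ V is indexed by a class,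
    -- so it is specified as a supremum instead of being written with ⋁.
    InV̌ : Pred Name (lsuc ℓ)
    InV̌ σ = ∃[ b ] IsSup _≤_ (λ x → ⟦ σ ＝ check x ⟧) b × b ∈ U.member

    V̌ᵤ : ∈-Structure (lsuc ℓ) ℓ
    V̌ᵤ = record
      { ∣M∣  = Σ Name InV̌
      ; _≈ᴹ_ = _~_ on proj₁
      ; _∈ᴹ_ = _E_ on proj₁
      }

    -- The subsets x of V̌_U.  Smallness of x is not demanded: whenever x is
    -- coded, or is pulled back to coded sets along a skeleton, x is small.
    record SubsetOfV̌ᵤ : Set (lsuc ℓ) where
      field
        member : Pred Name ℓ
        resp   : ∀ {σ τ} → σ ~ τ → σ ∈ member → τ ∈ member
        ⊆V̌ᵤ    : member ⊆ InV̌

    -- X ∈ U_A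
    Large : (A : MaximalAntichain) → Pred (Elem A) ℓ → Set ℓ
    Large A X = ⋁ {I = Σ (Elem A) X} (proj₁ ∘ proj₁) ∈ U.member

    Ult : MaximalAntichain → ∈-Structure (lsuc ℓ) ℓ
    Ult A = record
      { ∣M∣  = FunctionOn A
      ; _≈ᴹ_ = λ f g → Large A (λ a → app f a ≈ⱽ app g a)
      ; _∈ᴹ_ = λ f g → Large A (λ a → app f a ∈ⱽ app g a)
      }

    -- π_{A,∞}⁻¹[x]; the graph of π_{A,∞} is Mixes A, whose values are unique
    -- up to _~_, and x is to be closed under _~_.
    π⁻¹ : (A : MaximalAntichain) → Pred Name p → Pred (FunctionOn A) _
    π⁻¹ A x f = ∃[ τ ] Mixes A f τ × τ ∈ x

    -- {x ⊆ V̌_U | π_{A,∞}⁻¹[x] ∈ (M_A)ᶜ}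
    PullbackCoded : MaximalAntichain → Pred SubsetOfV̌ᵤ _
    PullbackCoded A x = Coded (Ult A) (π⁻¹ A (SubsetOfV̌ᵤ.member x))

    -- {x ⊆ V̌_U | x ∈ (Vᴮ/U)ᶜ}
    CodedInVᴮ/U : Pred SubsetOfV̌ᵤ _
    CodedInVᴮ/U x = Coded Vᴮ/U (SubsetOfV̌ᵤ.member x)

    IsSimple : Pred MaximalAntichain _
    IsSimple A = Coded (Ult A) (π⁻¹ A (_E Ġ))

    -- y = j(f)(b_A), computed in V̌_U: b is the element b_A common to j(A) and
    -- [Ġ]_U, and V̌_U ⊨ (b, y) ∈ j(f).
    IsValueAtGeneric : (A : MaximalAntichain) → FunctionOn A →
                       ∈-Structure.∣M∣ V̌ᵤ → Set _
    IsValueAtGeneric A f y =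
      ∃[ b ] (proj₁ b E check (asSet A)) × (proj₁ b E Ġ) ×
      ∃[ z ] IsOrderedPair V̌ᵤ z b y × (proj₁ z E check (graph f))

    record Skeleton : Set (lsuc ℓ) where
      field
        Idx       : Set ℓ
        antichain : Idx → MaximalAntichain
        directed  : ∀ i j → ∃[ k ] (antichain k ≤* antichain i)
                                 × (antichain k ≤* antichain j)
        j[]-coded : Coded Vᴮ/U
                      (λ σ → ∃[ i ] σ ~ check (asSet (antichain i)))
        generates : ∀ y → ∃[ i ] ∃[ f ] IsValueAtGeneric (antichain i) f y

    IsSimpleSkeleton : Pred Skeleton _
    IsSimpleSkeleton 𝔄 = ∀ i → IsSimple (Skeleton.antichain 𝔄 i)

{-# OPTIONS --safe #-}
module Submission where

open import Defs
open import Level using (Level; lift) renaming (suc to lsuc)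
open import Data.Bool using (Bool; true; false; T)
open import Data.Empty using (⊥-elim)
open import Data.Product using (Σ; ∃; ∃-syntax; _×_; _,_; proj₁; proj₂)
open import Data.Sum using (_⊎_; inj₁; inj₂; [_,_]′)
open import Data.Unit using (tt)
open import Function using (id; _∘_)
open import Function.Bundles using (_⇔_; mk⇔; module Equivalence)
open import Relation.Binary.PropositionalEquality using (_≡_; _≢_; subst)
  renaming (refl to ≡-refl; sym to ≡-sym)
open import Relation.Binary.Lattice.Structures using (IsBooleanAlgebra)
open import Relation.Nullary using (¬_; Dec; yes; no; contradiction)
open import Relation.Nullary.Decidable using (True; isYes; toWitness; fromWitness; decidable-stable)
open import Relation.Unary using (Pred; _∈_; _⊆_; _≐_; ⋂)
open import Axiom.ExcludedMiddle using (ExcludedMiddle)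
open import Axiom.Extensionality.Propositional using (Extensionality)

open Equivalence using (to; from)

-- Suppose π_C⁻¹[x] is coded by f_C for every C ∈ 𝔄, and put y_C = j(f_C)(b_C).
-- An element j(g)(b_A) lies in x iff it lies in y_C for all C ≤* A in 𝔄, hence
-- x = ⋃_B ⋂_{C ≤* B} y_C.  Since j[𝔄] is coded, this union can be formed in
-- Vᴮ/U, and Łoś's theorem for quantifiers over j[𝔄] identifies its members.
-- That Łoś theorem needs disjoint refinements of families in 𝔹, which come
-- from a well-ordering of the index set.
--
-- If h codes G_A and c is a name, then π_A([g]) E c iff the mixture of the
-- values ⟦ǧ(a) ∈ c⟧ is generic, iff ⟦ǧ(a) ∈ c⟧ ∈ h(a) for almost all a; so
-- a ↦ { z | ⟦ž ∈ c⟧ ∈ h(a) } codes the pullback of c.  Conversely Ġ itself is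
-- coded, and its pullback to M_A is G_A.

-- Kuratowski pairs in a possibly ill-founded structure.

module _ {a e : Level} (M : ∈-Structure a e) where
  open ∈-Structure M

  module OrderedPairs
    (≈-sym   : ∀ {x y} → x ≈ᴹ y → y ≈ᴹ x)
    (≈-refl  : ∀ {x} → x ≈ᴹ x)
    (≈-trans : ∀ {x y z} → x ≈ᴹ y → y ≈ᴹ z → x ≈ᴹ z)
    (∈-congʳ : ∀ {x y z} → y ≈ᴹ z → x ∈ᴹ y → x ∈ᴹ z) where

    private
      left : ∀ {z u v} → IsUnorderedPair M z u v → u ∈ᴹ z
      left {_} {u} z = from (z u) (inj₁ ≈-refl)

      right : ∀ {z u v} → IsUnorderedPair M z u v → v ∈ᴹ z
      right {_} {_} {v} z = from (z v) (inj₂ ≈-refl)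

      singleton : ∀ {z u w} → IsUnorderedPair M z u u → w ∈ᴹ z → w ≈ᴹ u
      singleton {w = w} z w∈z = [ id , id ]′ (to (z w) w∈z)

    -- Kuratowski's argument survives without extensionality: comparing members uses only the
    -- equality laws and congruence of `_∈ᴹ_` in its right argument.
    IsOrderedPair-injective : ∀ {z x y x′ y′} → IsOrderedPair M z x y →
                              IsOrderedPair M z x′ y′ → x ≈ᴹ x′ × y ≈ᴹ y′
    IsOrderedPair-injective {z} {x} {y} {x′} {y′}
                            (s , t , S , T , Z) (s′ , t′ , S′ , T′ , Z′) =
      x≈x′ , y≈y′
      where
      in-S : ∀ {w} → w ∈ᴹ s → w ≈ᴹ x
      in-S = singleton S
      in-S′ : ∀ {w} → w ∈ᴹ s′ → w ≈ᴹ x′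
      in-S′ = singleton S′
      in-T : ∀ {w} → w ∈ᴹ t → w ≈ᴹ x ⊎ w ≈ᴹ y
      in-T {w} = to (T w)
      in-T′ : ∀ {w} → w ∈ᴹ t′ → w ≈ᴹ x′ ⊎ w ≈ᴹ y′
      in-T′ {w} = to (T′ w)

      s′-cases : s′ ≈ᴹ s ⊎ s′ ≈ᴹ t
      s′-cases = to (Z s′) (left Z′)
      t′-cases : t′ ≈ᴹ s ⊎ t′ ≈ᴹ t
      t′-cases = to (Z t′) (right Z′)
      t-cases : t ≈ᴹ s′ ⊎ t ≈ᴹ t′
      t-cases = to (Z′ t) (right Z)

      x≈x′ : x ≈ᴹ x′
      x≈x′ with s′-cases
      ... | inj₁ s′≈s = in-S′ (∈-congʳ (≈-sym s′≈s) (left S))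
      ... | inj₂ s′≈t = in-S′ (∈-congʳ (≈-sym s′≈t) (left T))

      y′-cases : y′ ≈ᴹ x ⊎ y′ ≈ᴹ y
      y′-cases with t′-cases
      ... | inj₁ t′≈s = inj₁ (in-S (∈-congʳ t′≈s (right T′)))
      ... | inj₂ t′≈t = in-T (∈-congʳ t′≈t (right T′))

      y-cases : y ≈ᴹ x′ ⊎ y ≈ᴹ y′
      y-cases with t-cases
      ... | inj₁ t≈s′ = inj₁ (in-S′ (∈-congʳ t≈s′ (right T)))
      ... | inj₂ t≈t′ = in-T′ (∈-congʳ t≈t′ (right T))

      y≈y′ : y ≈ᴹ y′
      y≈y′ with y-cases | y′-cases
      ... | inj₂ y≈y′ | _         = y≈y′
      ... | inj₁ _    | inj₂ y′≈y = ≈-sym y′≈y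
      -- Both pairs have collapsed to a single point here.
      ... | inj₁ y≈x′ | inj₁ y′≈x =
        ≈-trans y≈x′ (≈-trans (≈-sym x≈x′) (≈-sym y′≈x))

-- Extensional equality and pairing for iterative sets.

module _ {ℓ : Level} where

  ≈ⱽ-refl : (x : V ℓ) → x ≈ⱽ x
  ≈ⱽ-refl (sup I f) = (λ i → i , ≈ⱽ-refl (f i)) , (λ i → i , ≈ⱽ-refl (f i))

  ≈ⱽ-sym : (x y : V ℓ) → x ≈ⱽ y → y ≈ⱽ x
  ≈ⱽ-sym (sup I f) (sup J g) (fg , gf) =
    (λ j → let (i , e) = gf j in i , ≈ⱽ-sym (f i) (g j) e) ,
    (λ i → let (j , e) = fg i in j , ≈ⱽ-sym (f i) (g j) e)

  ≈ⱽ-trans : (x y z : V ℓ) → x ≈ⱽ y → y ≈ⱽ z → x ≈ⱽ z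
  ≈ⱽ-trans (sup I f) (sup J g) (sup K h) (fg , gf) (gh , hg) =
    (λ i → let (j , e) = fg i ; (k , e′) = gh j
           in k , ≈ⱽ-trans (f i) (g j) (h k) e e′) ,
    (λ k → let (j , e′) = hg k ; (i , e) = gf j
           in i , ≈ⱽ-trans (f i) (g j) (h k) e e′)

  element-∈ⱽ : (x : V ℓ) (i : Index x) → element x i ∈ⱽ x
  element-∈ⱽ x i = i , ≈ⱽ-refl (element x i)

  ∈ⱽ-congˡ : (x y z : V ℓ) → x ≈ⱽ y → x ∈ⱽ z → y ∈ⱽ z
  ∈ⱽ-congˡ x y z x≈y (i , x≈zᵢ) =
    i , ≈ⱽ-trans y x (element z i) (≈ⱽ-sym x y x≈y) x≈zᵢ

  ∈ⱽ-congʳ : (x y z : V ℓ) → y ≈ⱽ z → x ∈ⱽ y → x ∈ⱽ z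
  ∈ⱽ-congʳ x (sup J g) (sup K h) (gh , _) (j , x≈gⱼ) =
    let (k , gⱼ≈hₖ) = gh j in k , ≈ⱽ-trans x (g j) (h k) x≈gⱼ gⱼ≈hₖ

  ｛｝-isUnorderedPair : (x y w : V ℓ) → w ∈ⱽ ｛ x , y ｝ ⇔ (w ≈ⱽ x ⊎ w ≈ⱽ y)
  ｛｝-isUnorderedPair x y w = mk⇔
    (λ { (lift true , e) → inj₁ e ; (lift false , e) → inj₂ e })
    [ (λ e → lift true , e) , (λ e → lift false , e) ]′

  𝐕 : ∈-Structure (lsuc ℓ) ℓ
  𝐕 = record { ∣M∣ = V ℓ ; _≈ᴹ_ = _≈ⱽ_ ; _∈ᴹ_ = _∈ⱽ_ }

  ⟨⟩-injectiveˡ : (x y x′ y′ : V ℓ) → ⟨ x , y ⟩ ≈ⱽ ⟨ x′ , y′ ⟩ → x ≈ⱽ x′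
  ⟨⟩-injectiveˡ x y x′ y′ e =
    proj₁ (IsOrderedPair-injective {z = ⟨ x , y ⟩}
      ( ｛ x , x ｝ , ｛ x , y ｝ , ｛｝-isUnorderedPair x x
      , ｛｝-isUnorderedPair x y , ｛｝-isUnorderedPair ｛ x , x ｝ ｛ x , y ｝ )
      ( ｛ x′ , x′ ｝ , ｛ x′ , y′ ｝ , ｛｝-isUnorderedPair x′ x′
      , ｛｝-isUnorderedPair x′ y′
      , λ w → mk⇔
          (λ w∈ → to (｛｝-isUnorderedPair _ _ w)
            (∈ⱽ-congʳ w ⟨ x , y ⟩ ⟨ x′ , y′ ⟩ e w∈))
          (λ w∈ → ∈ⱽ-congʳ w ⟨ x′ , y′ ⟩ ⟨ x , y ⟩
            (≈ⱽ-sym ⟨ x , y ⟩ ⟨ x′ , y′ ⟩ e)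
            (from (｛｝-isUnorderedPair _ _ w) w∈)) ))
    where
    open OrderedPairs 𝐕 (λ {u} {v} → ≈ⱽ-sym u v) (λ {u} → ≈ⱽ-refl u)
      (λ {u} {v} {w} → ≈ⱽ-trans u v w) (λ {u} {v} {w} → ∈ⱽ-congʳ u v w)

-- Zermelo's well-ordering theorem.  Subsets are Bool-valued, so that mutual
-- inclusion implies equality; the order compares points by the members of the
-- least tower of subsets closed under adding a chosen point and under unions.
module WellOrdering
  (em  : ∀ {a : Level} → ExcludedMiddle a)
  (ext : ∀ {a b : Level} → Extensionality a b)
  {ℓ : Level} (X : Set ℓ) where

  Subset : Set ℓ
  Subset = X → Bool

  infix 4 _⊑_
  _⊑_ : Subset → Subset → Set ℓ
  S ⊑ R = ∀ x → T (S x) → T (R x)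

  ⊑-antisym : ∀ {S R} → S ⊑ R → R ⊑ S → S ≡ R
  ⊑-antisym {S} {R} S⊑R R⊑S = ext λ x → bool (S x) (R x) (S⊑R x) (R⊑S x)
    where
    bool : ∀ b c → (T b → T c) → (T c → T b) → b ≡ c
    bool true  true  _ _ = ≡-refl
    bool true  false f _ = ⊥-elim (f tt)
    bool false true  _ g = ⊥-elim (g tt)
    bool false false _ _ = ≡-refl

  private
    -- Excluded middle for a Σ-type returns a witness, so `em` itself serves as the choice function.
    -- Taking the decision as an argument lets `nextView` match on it.
    nextBy : (S : Subset) → Dec (∃ λ x → ¬ T (S x)) → Subset
    nextBy S (yes (k , _)) x = isYes (em {P = T (S x) ⊎ x ≡ k})
    nextBy S (no _)          = S

  next : Subset → Subset
  next S = nextBy S em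

  data NextView (S : Subset) : Set ℓ where
    adds : ∀ k → ¬ T (S k) → (∀ x → T (next S x) ⇔ (T (S x) ⊎ x ≡ k)) → NextView S
    full : (∀ x → T (S x)) → NextView S

  nextView : ∀ S → NextView S
  nextView S = view em ≡-refl
    where
    view : (d : Dec (∃ λ x → ¬ T (S x))) → next S ≡ nextBy S d → NextView S
    view (yes (k , k∉S)) eq = adds k k∉S λ x → mk⇔
      (λ h → toWitness (subst (λ R → T (R x)) eq h))
      (λ h → subst (λ R → T (R x)) (≡-sym eq) (fromWitness h))
    view (no none) _ = full λ x → decidable-stable em λ x∉S → none (x , x∉S)

  ⊑-next : ∀ S → S ⊑ next S
  ⊑-next S x x∈S with em {P = ∃ λ x → ¬ T (S x)}
  ... | yes _ = fromWitness (inj₁ x∈S)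
  ... | no _  = x∈S

  ⋃ : (Subset → Bool) → Subset
  ⋃ 𝓕 x = isYes (em {P = ∃ λ S → T (𝓕 S) × T (S x)})

  ⊑-⋃ : ∀ {𝓕 S} → T (𝓕 S) → S ⊑ ⋃ 𝓕
  ⊑-⋃ S∈𝓕 x x∈S = fromWitness (_ , S∈𝓕 , x∈S)

  ⋃-⊑ : ∀ {𝓕 R} → (∀ S → T (𝓕 S) → S ⊑ R) → ⋃ 𝓕 ⊑ R
  ⋃-⊑ h x x∈ = let (S , S∈𝓕 , x∈S) = toWitness x∈ in h S S∈𝓕 x x∈S

  data Tower : Subset → Set ℓ where
    step  : ∀ {S} → Tower S → Tower (next S)
    union : ∀ 𝓕 → (∀ S → T (𝓕 S) → Tower S) → Tower (⋃ 𝓕)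

  -- The extreme points of the Bourbaki-Witt argument; that every tower member is one makes the
  -- tower linearly ordered by inclusion.
  Extreme : Subset → Set ℓ
  Extreme R = ∀ {S} → Tower S → S ⊑ R → S ≡ R ⊎ next S ⊑ R

  -- Induction on the tower member `S`; a union with some member not inside `R` contains `next R`,
  -- because that member does.
  comparable : ∀ {R} → Extreme R → ∀ {S} → Tower S → S ⊑ R ⊎ next R ⊑ S
  comparable ex (step {S} tS) with comparable ex tS
  ... | inj₂ R⁺⊑S = inj₂ λ x x∈ → ⊑-next S x (R⁺⊑S x x∈)
  ... | inj₁ S⊑R with ex tS S⊑R
  ...   | inj₁ ≡-refl = inj₂ λ _ → id
  ...   | inj₂ S⁺⊑R   = inj₁ S⁺⊑R
  comparable {R} ex (union 𝓕 t𝓕)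
    with em {P = ∃ λ S → Σ (T (𝓕 S)) λ _ → ¬ S ⊑ R}
  ... | no none = inj₁ (⋃-⊑ {𝓕} λ S S∈𝓕 →
                    decidable-stable em λ S⋢R → none (S , S∈𝓕 , S⋢R))
  ... | yes (S , S∈𝓕 , S⋢R) with comparable ex (t𝓕 S S∈𝓕)
  ...   | inj₁ S⊑R  = contradiction S⊑R S⋢R
  ...   | inj₂ R⁺⊑S = inj₂ λ x x∈ → ⊑-⋃ {𝓕} S∈𝓕 x (R⁺⊑S x x∈)

  -- Induction on `R`, comparing `S` with the predecessor of `R`, or with a member of the union that
  -- is not inside `S`.
  extreme : ∀ {R} → Tower R → Extreme R
  extreme (step {R} tR) {S} tS S⊑R⁺ with comparable (extreme tR) tS
  ... | inj₂ R⁺⊑S = inj₁ (⊑-antisym S⊑R⁺ R⁺⊑S)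
  ... | inj₁ S⊑R with extreme tR tS S⊑R
  ...   | inj₁ ≡-refl = inj₂ λ _ → id
  ...   | inj₂ S⁺⊑R   = inj₂ λ x x∈ → ⊑-next R x (S⁺⊑R x x∈)
  extreme (union 𝓕 t𝓕) {S} tS S⊑⋃
    with em {P = ∃ λ R → Σ (T (𝓕 R)) λ _ → ¬ R ⊑ S}
  ... | no none = inj₁ (⊑-antisym S⊑⋃ (⋃-⊑ {𝓕} λ R R∈𝓕 →
                    decidable-stable em λ R⋢S → none (R , R∈𝓕 , R⋢S)))
  ... | yes (R , R∈𝓕 , R⋢S) with comparable (extreme (t𝓕 R R∈𝓕)) tS
  ...   | inj₂ R⁺⊑S = contradiction (λ x x∈ → R⁺⊑S x (⊑-next R x x∈)) R⋢S
  ...   | inj₁ S⊑R with extreme (t𝓕 R R∈𝓕) tS S⊑R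
  ...     | inj₁ ≡-refl = contradiction (λ _ → id) R⋢S
  ...     | inj₂ S⁺⊑R   = inj₂ λ x x∈ → ⊑-⋃ {𝓕} R∈𝓕 x (S⁺⊑R x x∈)

  infix 4 _<_
  _<_ : X → X → Set ℓ
  j < k = ∃[ S ] Tower S × T (S j) × ¬ T (S k)

  -- k is the point added to the largest member of the tower disjoint from P.
  least : ∀ {p} (P : X → Set p) → ∃ P →
          ∃[ k ] P k × (∀ j → P j → j ≢ k → k < j) × (∀ j → P j → ¬ j < k)
  least P (p , Pp) = least-of (nextView M)
    where
    Disjoint : Subset → Set _
    Disjoint S = Tower S × (∀ x → T (S x) → ¬ P x)

    𝓕 : Subset → Bool
    𝓕 S = isYes (em {P = Disjoint S})

    M : Subset
    M = ⋃ 𝓕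

    M-tower : Tower M
    M-tower = union 𝓕 λ S S∈𝓕 → proj₁ (toWitness S∈𝓕)

    M-disjoint : ∀ x → T (M x) → ¬ P x
    M-disjoint x x∈M = let (S , S∈𝓕 , x∈S) = toWitness x∈M
                       in proj₂ (toWitness S∈𝓕) x x∈S

    least-of : NextView M →
               ∃[ k ] P k × (∀ j → P j → j ≢ k → k < j) × (∀ j → P j → ¬ j < k)
    least-of (full all) = contradiction Pp (M-disjoint p (all p))
    least-of (adds k k∉M added) = k , Pk , below , minimal
      where
      k∈M⁺ : T (next M k)
      k∈M⁺ = from (added k) (inj₂ ≡-refl)

      -- Otherwise `next M` would be disjoint from `P`, hence contained in `M`, although it contains
      -- `k`.
      Pk : P k
      Pk = decidable-stable em λ ¬Pk → k∉M
        (⊑-⋃ {𝓕} {next M} (fromWitness (step M-tower , λ x x∈ →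
          [ M-disjoint x , (λ { ≡-refl → ¬Pk }) ]′ (to (added x) x∈))) k k∈M⁺)

      below : ∀ j → P j → j ≢ k → k < j
      below j Pj j≢k = next M , step M-tower , k∈M⁺ , λ j∈ →
        [ (λ j∈M → M-disjoint j j∈M Pj) , j≢k ]′ (to (added j) j∈)

      minimal : ∀ j → P j → ¬ j < k
      minimal j Pj (S , tS , j∈S , k∉S) with comparable (extreme M-tower) tS
      ... | inj₁ S⊑M  = M-disjoint j (S⊑M j j∈S) Pj
      ... | inj₂ M⁺⊑S = k∉S (M⁺⊑S k k∈M⁺)

  connex : ∀ i j → i ≢ j → i < j ⊎ j < i
  connex i j i≢j with least (λ k → k ≡ i ⊎ k ≡ j) (i , inj₁ ≡-refl)
  ... | _ , inj₁ ≡-refl , below , _ = inj₁ (below j (inj₂ ≡-refl) (i≢j ∘ ≡-sym))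
  ... | _ , inj₂ ≡-refl , below , _ = inj₂ (below i (inj₁ ≡-refl) i≢j)

-- Natural deduction and disjoint refinements in a complete Boolean algebra.

module Forcing
  (em  : ∀ {a : Level} → ExcludedMiddle a)
  (ext : ∀ {a b : Level} → Extensionality a b)
  {ℓ : Level} (𝔹 : CompleteBooleanAlgebra ℓ) where

  open CompleteBooleanAlgebra 𝔹
  open IsBooleanAlgebra isBooleanAlgebra public
    using (antisym; reflexive; maximum; minimum; transpose-⇨; transpose-∧;
           ∧-greatest; ∨-least; x∧y≤x; x∧y≤y; x≤x∨y; y≤x∨y)
    renaming (refl to ≤-refl; trans to ≤-trans)

  -- Inequalities p ≤ x are read as "p forces x"; the rules below are those of
  -- natural deduction, with discharged hypotheses forced by smaller conditions.

  ∧-elimˡ : ∀ {p x y} → p ≤ x ∧ y → p ≤ x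
  ∧-elimˡ h = ≤-trans h (x∧y≤x _ _)

  ∧-elimʳ : ∀ {p x y} → p ≤ x ∧ y → p ≤ y
  ∧-elimʳ h = ≤-trans h (x∧y≤y _ _)

  ⊥-elimᶠ : ∀ {p x} → p ≤ ⊥ → p ≤ x
  ⊥-elimᶠ h = ≤-trans h (minimum _)

  ⇨-intro : ∀ {p x y} → (∀ q → q ≤ p → q ≤ x → q ≤ y) → p ≤ x ⇨ y
  ⇨-intro h = transpose-⇨ (h _ (x∧y≤x _ _) (x∧y≤y _ _))

  ⇨-elim : ∀ {p x y} → p ≤ x ⇨ y → p ≤ x → p ≤ y
  ⇨-elim h h′ = ≤-trans (∧-greatest ≤-refl h′) (transpose-∧ h)

  -- Moving the side condition `p` across `⇨` reduces the rule to the universal property of the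
  -- join; this is where distributivity enters.
  ∨-elim : ∀ {p x y z} → p ≤ x ∨ y → (∀ q → q ≤ p → q ≤ x → q ≤ z) →
           (∀ q → q ≤ p → q ≤ y → q ≤ z) → p ≤ z
  ∨-elim h hˡ hʳ = ⇨-elim
    (≤-trans h (∨-least (transpose-⇨ (hˡ _ (x∧y≤y _ _) (x∧y≤x _ _)))
                        (transpose-⇨ (hʳ _ (x∧y≤y _ _) (x∧y≤x _ _)))))
    ≤-refl

  ⋁-elim : ∀ {I : Set ℓ} {F : I → Carrier} {p r} → p ≤ ⋁ F →
           (∀ i q → q ≤ p → q ≤ F i → q ≤ r) → p ≤ r
  ⋁-elim {F = F} h f = ⇨-elim
    (≤-trans h (proj₂ (⋁-isSup F) _ λ i →
      transpose-⇨ (f i _ (x∧y≤y _ _) (x∧y≤x _ _))))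
    ≤-refl

  ⋁-intro : ∀ {I : Set ℓ} {F : I → Carrier} {p} i → p ≤ F i → p ≤ ⋁ F
  ⋁-intro {F = F} i h = ≤-trans h (proj₁ (⋁-isSup F) i)

  ⋀-elim : ∀ {I : Set ℓ} {F : I → Carrier} {p} → p ≤ ⋀ F → ∀ i → p ≤ F i
  ⋀-elim {F = F} h i = ≤-trans h (proj₁ (⋀-isInf F) i)

  ⋀-intro : ∀ {I : Set ℓ} {F : I → Carrier} {p} → (∀ i → p ≤ F i) → p ≤ ⋀ F
  ⋀-intro {F = F} = proj₂ (⋀-isInf F) _

  ∁-elim : ∀ {p x} → p ≤ ∁ x → p ≤ x → p ≤ ⊥
  ∁-elim h = ⇨-elim (≤-trans h (x≤x∨y _ _))

  ∁-intro : ∀ {p x} → (∀ q → q ≤ p → q ≤ x → q ≤ ⊥) → p ≤ ∁ x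
  ∁-intro h = ≤-trans (⇨-intro h) (∨-least ≤-refl (minimum _))

  byCases : ∀ x {p z} → (∀ q → q ≤ p → q ≤ x → q ≤ z) →
            (∀ q → q ≤ p → q ≤ ∁ x → q ≤ z) → p ≤ z
  -- `x ⇨ x` unfolds to `∁ x ∨ x`, so a trivial implication yields the excluded middle.
  byCases x h h′ = ∨-elim (transpose-⇨ (x∧y≤y _ x)) h′ h

  -- Each `d i` loses the join of its predecessors in a well-ordering. The total join stays the
  -- same: a condition left over would meet some least `d k`, miss all earlier ones, and so meet
  -- `d′ k`.
  disjointify : ∀ {I : Set ℓ} (d : I → Carrier) → ∃[ d′ ]
    (∀ i → d′ i ≤ d i) × (∀ i j → i ≡ j ⊎ d′ i ∧ d′ j ≤ ⊥) × ⋁ d ≤ ⋁ d′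
  disjointify {I} d = d′ , (λ i → x∧y≤x _ _) , disjoint
                    , ⋁-elim ≤-refl (λ i q _ q≤dᵢ → ≤-trans q≤dᵢ (covers i))
    where
    open WellOrdering em ext I

    d′ : I → Carrier
    d′ i = d i ∧ ∁ ⋁ {I = ∃ (_< i)} (d ∘ proj₁)

    below : ∀ {i j} → i < j → d′ i ∧ d′ j ≤ ⊥
    below {i} i<j = ∁-elim (∧-elimʳ (x∧y≤y _ _))
                      (⋁-intro (i , i<j) (∧-elimˡ (x∧y≤x _ _)))

    disjoint : ∀ i j → i ≡ j ⊎ d′ i ∧ d′ j ≤ ⊥
    disjoint i j with em {P = i ≡ j}
    ... | yes i≡j = inj₁ i≡j
    ... | no i≢j with connex i j i≢j
    ...   | inj₁ i<j = inj₂ (below i<j)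
    ...   | inj₂ j<i = inj₂ (≤-trans (∧-greatest (x∧y≤y _ _) (x∧y≤x _ _))
                                     (below j<i))

    covers : ∀ i → d i ≤ ⋁ d′
    covers i = byCases (⋁ d′) (λ _ _ → id) λ q q≤dᵢ q≤∁ →
      decidable-stable em λ q≰ → uncovered q q≤∁ (least (Meets q)
        (i , λ q∧dᵢ≤⊥ → q≰ (⊥-elimᶠ
          (≤-trans (∧-greatest ≤-refl q≤dᵢ) q∧dᵢ≤⊥))))
      where
      Meets : Carrier → I → Set ℓ
      Meets q k = ¬ q ∧ d k ≤ ⊥

      uncovered : ∀ q → q ≤ ∁ ⋁ d′ →
                  ¬ (∃[ k ] Meets q k × (∀ j → Meets q j → j ≢ k → k < j)
                            × (∀ j → Meets q j → ¬ j < k))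
      uncovered q q≤∁ (k , meets , _ , minimal) = meets (∁-elim
        (≤-trans (x∧y≤x _ _) q≤∁)
        (⋁-intro k (∧-greatest (x∧y≤y _ _) (∁-intro λ r r≤ r≤⋁ →
          ⋁-elim r≤⋁ λ { (j , j<k) s s≤r s≤dⱼ →
            ≤-trans (∧-greatest (≤-trans s≤r (∧-elimˡ r≤)) s≤dⱼ)
                    (decidable-stable em λ meetsⱼ → minimal j meetsⱼ j<k) }))))

  -- Forcing equality and membership of names.

  infix 4 _⊩_≃_ _⊩_ε_

  -- Records instead of bare inequalities, so that the names can be inferred.

  record _⊩_≃_ (p : Carrier) (σ τ : Name 𝔹) : Set ℓ where
    constructor ≃⟨_⟩
    field ≤⟦＝⟧ : p ≤ ⟦_＝_⟧ 𝔹 σ τ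

  record _⊩_ε_ (p : Carrier) (σ τ : Name 𝔹) : Set ℓ where
    constructor ε⟨_⟩
    field ≤⟦∈⟧ : p ≤ ⟦_∈_⟧ 𝔹 σ τ

  open _⊩_≃_ public
  open _⊩_ε_ public

  forces-≃ : ∀ {p} σ τ → p ≤ ⟦_＝_⟧ 𝔹 σ τ → p ⊩ σ ≃ τ
  forces-≃ _ _ = ≃⟨_⟩

  forces-ε : ∀ {p} σ τ → p ≤ ⟦_∈_⟧ 𝔹 σ τ → p ⊩ σ ε τ
  forces-ε _ _ = ε⟨_⟩

  ≃-weaken : ∀ {p q σ τ} → q ≤ p → p ⊩ σ ≃ τ → q ⊩ σ ≃ τ
  ≃-weaken q≤p ≃⟨ h ⟩ = ≃⟨ ≤-trans q≤p h ⟩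

  ε-weaken : ∀ {p q σ τ} → q ≤ p → p ⊩ σ ε τ → q ⊩ σ ε τ
  ε-weaken q≤p ε⟨ h ⟩ = ε⟨ ≤-trans q≤p h ⟩

  module _ {J : Set ℓ} {τ : J → Name 𝔹} {c : J → Carrier} where

    ε-intro : ∀ {p σ} j → p ≤ c j → p ⊩ σ ≃ τ j → p ⊩ σ ε name J τ c
    ε-intro j h ≃⟨ e ⟩ = ε⟨ ⋁-intro j (∧-greatest h e) ⟩

    ε-elim : ∀ {p r σ} → p ⊩ σ ε name J τ c →
             (∀ j q → q ≤ p → q ≤ c j → q ⊩ σ ≃ τ j → q ≤ r) → p ≤ r
    ε-elim ε⟨ h ⟩ f = ⋁-elim h λ j q q≤p q≤ →
      f j q q≤p (∧-elimˡ q≤) ≃⟨ ∧-elimʳ q≤ ⟩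

    module _ {I : Set ℓ} {σ : I → Name 𝔹} {b : I → Carrier} where

      ≃-elimˡ : ∀ {p} → p ⊩ name I σ b ≃ name J τ c →
                ∀ i → p ≤ b i → p ⊩ σ i ε name J τ c
      ≃-elimˡ ≃⟨ h ⟩ i p≤ = ε⟨ ⇨-elim (⋀-elim (∧-elimˡ h) i) p≤ ⟩

      ≃-elimʳ : ∀ {p r} → p ⊩ name I σ b ≃ name J τ c → ∀ j → p ≤ c j →
                (∀ i q → q ≤ p → q ≤ b i → q ⊩ σ i ≃ τ j → q ≤ r) → p ≤ r
      ≃-elimʳ ≃⟨ h ⟩ j p≤ f =
        ⋁-elim (⇨-elim (⋀-elim (∧-elimʳ h) j) p≤) λ i q q≤p q≤ →
          f i q q≤p (∧-elimˡ q≤) ≃⟨ ∧-elimʳ q≤ ⟩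

      ≃-intro : ∀ {p} →
        (∀ i q → q ≤ p → q ≤ b i → q ⊩ σ i ε name J τ c) →
        (∀ j q → q ≤ p → q ≤ c j → q ≤ ⋁ λ i → b i ∧ ⟦_＝_⟧ 𝔹 (σ i) (τ j)) →
        p ⊩ name I σ b ≃ name J τ c
      ≃-intro l r = ≃⟨ ∧-greatest
        (⋀-intro λ i → ⇨-intro λ q q≤p q≤b → ≤⟦∈⟧ (l i q q≤p q≤b))
        (⋀-intro λ j → ⇨-intro (r j)) ⟩

  ≃-refl : ∀ {p σ} → p ⊩ σ ≃ σ
  ≃-refl {σ = name I σ b} = ≃-intro
    (λ i q _ q≤b → ε-intro i q≤b ≃-refl)
    (λ i q _ q≤b → ⋁-intro i (∧-greatest q≤b (≤⟦＝⟧ (≃-refl {σ = σ i}))))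

  ≃-sym : ∀ {p σ τ} → p ⊩ σ ≃ τ → p ⊩ τ ≃ σ
  ≃-sym {σ = name I σ b} {name J τ c} h = ≃-intro
    (λ j q q≤p q≤c → ε⟨ ≃-elimʳ (≃-weaken q≤p h) j q≤c (λ i r r≤q r≤b e →
      ≤⟦∈⟧ (ε-intro {τ = σ} {c = b} i r≤b (≃-sym {σ = σ i} {τ j} e))) ⟩)
    (λ i q q≤p q≤b → ε-elim (≃-elimˡ (≃-weaken q≤p h) i q≤b) λ j r r≤q r≤c e →
      ⋁-intro j (∧-greatest r≤c (≤⟦＝⟧ (≃-sym {σ = σ i} {τ j} e))))

  ≃-trans : ∀ {p σ τ ρ} → p ⊩ σ ≃ τ → p ⊩ τ ≃ ρ → p ⊩ σ ≃ ρ
  ≃-trans {σ = name I σ b} {name J τ c} {name K ρ d} h h′ = ≃-intro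
    (λ i q q≤p q≤b → ε⟨
      ε-elim (≃-elimˡ (≃-weaken q≤p h) i q≤b) (λ j r r≤q r≤c e →
      ε-elim (≃-elimˡ (≃-weaken (≤-trans r≤q q≤p) h′) j r≤c) λ k s s≤r s≤d e′ →
      ≤⟦∈⟧ (ε-intro {τ = ρ} {c = d} k s≤d
        (≃-trans {σ = σ i} {τ j} {ρ k} (≃-weaken s≤r e) e′))) ⟩)
    (λ k q q≤p q≤d →
      ≃-elimʳ (≃-weaken q≤p h′) k q≤d λ j r r≤q r≤c e′ →
      ≃-elimʳ (≃-weaken (≤-trans r≤q q≤p) h) j r≤c λ i s s≤r s≤b e →
      ⋁-intro i (∧-greatest s≤b (≤⟦＝⟧
        (≃-trans {σ = σ i} {τ j} {ρ k} e (≃-weaken s≤r e′)))))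

  ε-congˡ : ∀ {p σ σ′ τ} → p ⊩ σ ≃ σ′ → p ⊩ σ ε τ → p ⊩ σ′ ε τ
  ε-congˡ {τ = name J τ c} e h = ε⟨ ε-elim h (λ j q q≤p q≤c e′ →
    ≤⟦∈⟧ (ε-intro {τ = τ} {c = c} j q≤c
      (≃-trans (≃-sym (≃-weaken q≤p e)) e′))) ⟩

  ε-congʳ : ∀ {p σ τ τ′} → p ⊩ τ ≃ τ′ → p ⊩ σ ε τ → p ⊩ σ ε τ′
  ε-congʳ {τ = name J τ c} {name K ρ d} e h = ε⟨ ε-elim h (λ j q q≤p q≤c e′ →
    ≤⟦∈⟧ (ε-congˡ (≃-sym e′) (≃-elimˡ (≃-weaken q≤p e) j q≤c))) ⟩

  -- Standard names and absoluteness.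

  infix 9 _ˇ
  _ˇ : V ℓ → Name 𝔹
  _ˇ = check 𝔹

  ε-ˇ-intro : ∀ {p σ} (y x : V ℓ) → y ∈ⱽ x → p ⊩ σ ≃ y ˇ → p ⊩ σ ε x ˇ

  ≈⇒≃ : ∀ {p} (x y : V ℓ) → x ≈ⱽ y → p ⊩ x ˇ ≃ y ˇ
  ≈⇒≃ (sup I f) (sup J g) (fg , gf) = ≃-intro
    (λ i q _ q≤⊤ → let (j , e) = fg i in ε-intro j q≤⊤ (≈⇒≃ (f i) (g j) e))
    (λ j q _ q≤⊤ → let (i , e) = gf j in
      ⋁-intro i (∧-greatest q≤⊤ (≤⟦＝⟧ (≈⇒≃ (f i) (g j) e))))

  ε-ˇ-intro y (sup I f) (i , e) h =
    ε-intro i (maximum _) (≃-trans h (≈⇒≃ y (f i) e))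

  ε-ˇ-elim : ∀ {p r σ} (x : V ℓ) → p ⊩ σ ε x ˇ →
             (∀ i q → q ≤ p → q ⊩ σ ≃ element x i ˇ → q ≤ r) → p ≤ r
  ε-ˇ-elim (sup I f) h k = ε-elim h λ i q q≤p _ → k i q q≤p

  -- Turns a forced existential into an actual index: were `p` incompatible with every `F i`, it
  -- would lie below `⊥`.
  nonzero-witness : ∀ {I : Set ℓ} {F : I → Carrier} {p} → ¬ p ≤ ⊥ → p ≤ ⋁ F →
                    ∃[ i ] ¬ p ∧ F i ≤ ⊥
  nonzero-witness p≰⊥ h = decidable-stable em λ none → p≰⊥
    (⋁-elim h λ i q q≤p q≤Fᵢ → ≤-trans (∧-greatest q≤p q≤Fᵢ)
      (decidable-stable em λ meets → none (i , meets)))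

  -- Recursion on both sets, shrinking the condition at each level to its nonzero meet with the
  -- value at the index found.
  ≃⇒≈ : ∀ {p} (x y : V ℓ) → ¬ p ≤ ⊥ → p ⊩ x ˇ ≃ y ˇ → x ≈ⱽ y
  ≃⇒≈ (sup I f) (sup J g) p≰⊥ h =
    (λ i → let (j , n) = nonzero-witness p≰⊥ (≤⟦∈⟧ (≃-elimˡ h i (maximum _)))
           in j , ≃⇒≈ (f i) (g j) n ≃⟨ ∧-elimʳ (x∧y≤y _ _) ⟩) ,
    (λ j → let (i , n) = nonzero-witness p≰⊥
                 (⇨-elim (⋀-elim (∧-elimʳ (≤⟦＝⟧ h)) j) (maximum _))
           in i , ≃⇒≈ (f i) (g j) n ≃⟨ ∧-elimʳ (x∧y≤y _ _) ⟩)

  nonzero-or-⊥ : ∀ {p r} → (¬ p ≤ ⊥ → p ≤ r) → p ≤ r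
  nonzero-or-⊥ {p} h with em {P = p ≤ ⊥}
  ... | yes p≤⊥ = ⊥-elimᶠ p≤⊥
  ... | no p≰⊥  = h p≰⊥

  ≃-absolute : ∀ {p r} (x y : V ℓ) → p ⊩ x ˇ ≃ y ˇ → (x ≈ⱽ y → p ≤ r) → p ≤ r
  ≃-absolute x y h k = nonzero-or-⊥ λ p≰⊥ → k (≃⇒≈ x y p≰⊥ h)

  ≃-ext-ˇ : ∀ {p I σ b} (x : V ℓ) →
            (∀ i q → q ≤ p → q ≤ b i → q ⊩ σ i ε x ˇ) →
            (∀ k → p ⊩ element x k ˇ ε name I σ b) → p ⊩ name I σ b ≃ x ˇ
  ≃-ext-ˇ (sup K f) l r = ≃-intro l λ k q q≤p _ →
    ε-elim (ε-weaken q≤p (r k)) λ i s _ s≤b e →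
      ⋁-intro i (∧-greatest s≤b (≤⟦＝⟧ (≃-sym e)))

  -- Mixing standard names.

  module _ {I : Set ℓ} (p : I → Carrier) (F : I → V ℓ) where

    mix : Name 𝔹
    mix = name (∃ (Index ∘ F)) (λ (i , k) → element (F i) k ˇ) (p ∘ proj₁)

    -- Pieces may overlap where their values agree, since one element of an antichain can be indexed
    -- repeatedly.
    Compatible : Set ℓ
    Compatible = ∀ i j → F i ≈ⱽ F j ⊎ p i ∧ p j ≤ ⊥

    mix-mixes : Compatible → ∀ i → p i ⊩ mix ≃ F i ˇ
    mix-mixes compatible i = ≃-ext-ˇ (F i)
      (λ (j , k) q q≤pᵢ q≤pⱼ → [
        (λ Fⱼ≈Fᵢ → ε-ˇ-intro (element (F j) k) (F i)
          (∈ⱽ-congʳ (element (F j) k) (F j) (F i) Fⱼ≈Fᵢ (element-∈ⱽ (F j) k))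
          ≃-refl) ,
        (λ ≤⊥ → ε⟨ ⊥-elimᶠ (≤-trans (∧-greatest q≤pⱼ q≤pᵢ) ≤⊥) ⟩) ]′
        (compatible j i))
      (λ k → ε-intro (i , k) ≤-refl ≃-refl)

  -- Maximal antichains, functions on them, and refinement.

  module _ (A : MaximalAntichain 𝔹) where
    open MaximalAntichain A
    open IsAntichain isAntichain

    private
      ≈-sym : ∀ {b c} → b ≈ c → c ≈ b
      ≈-sym {b} {c} = ≈ⱽ-sym (element underlying b) (element underlying c)

      ≈-trans : ∀ {b c d} → b ≈ c → c ≈ d → b ≈ d
      ≈-trans {b} {c} {d} = ≈ⱽ-trans (element underlying b)
        (element underlying c) (element underlying d)

    antichain-disjoint : (a a′ : Elem) →
                         proj₁ a ≈ proj₁ a′ ⊎ proj₁ a ∧ proj₁ a′ ≤ ⊥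
    antichain-disjoint a a′ with em {P = proj₁ a ≈ proj₁ a′}
    ... | yes e = inj₁ e
    ... | no ne = inj₂ (reflexive (incompatible (proj₂ a) (proj₂ a′) ne))

    antichain-overlap : ∀ {p r} (a a′ : Elem) → p ≤ proj₁ a → p ≤ proj₁ a′ →
                        (proj₁ a ≈ proj₁ a′ → p ≤ r) → p ≤ r
    antichain-overlap a a′ h h′ k =
      [ k , (λ ≤⊥ → ⊥-elimᶠ (≤-trans (∧-greatest h h′) ≤⊥)) ]′
      (antichain-disjoint a a′)

    -- Were the complement of the join nonzero, adjoining it would still give an antichain;
    -- maximality then puts it into the antichain, hence below its own complement.
    antichain-cover : ∀ {p} → p ≤ ⋁ {I = Elem} proj₁
    antichain-cover = byCases (⋁ proj₁) (λ _ _ → id) λ q _ q≤∁ →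
      ⊥-elimᶠ (≤-trans q≤∁ (decidable-stable em λ rest≰⊥ → rest≰⊥
        (∁-elim ≤-refl (⋁-intro (rest , rest-∈ rest≰⊥) ≤-refl))))
      where
      rest : Carrier
      rest = ∁ ⋁ {I = Elem} proj₁

      extended : Pred Carrier ℓ
      extended b = member b ⊎ b ≈ rest

      meets-rest : ∀ {b c} → member b → c ≈ rest → b ∧ c ≤ ⊥
      meets-rest b∈ c≈ = ∁-elim (≤-trans (x∧y≤y _ _) (reflexive c≈))
                                (⋁-intro (_ , b∈) (x∧y≤x _ _))

      rest-∈ : ¬ rest ≤ ⊥ → member rest
      rest-∈ rest≰⊥ = maximal extended record
        { resp = λ { e (inj₁ b∈) → inj₁ (resp e b∈)
                   ; e (inj₂ b≈) → inj₂ (≈-trans (≈-sym e) b≈) }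
        ; nonzero = λ { (inj₁ b∈) → nonzero b∈
                      ; (inj₂ b≈) b≈⊥ →
                          rest≰⊥ (reflexive (≈-trans (≈-sym b≈) b≈⊥)) }
        ; incompatible = λ
          { (inj₁ b∈) (inj₁ c∈) ne → incompatible b∈ c∈ ne
          ; (inj₁ b∈) (inj₂ c≈) _ → antisym (meets-rest b∈ c≈) (minimum _)
          ; (inj₂ b≈) (inj₁ c∈) _ → antisym
              (≤-trans (∧-greatest (x∧y≤y _ _) (x∧y≤x _ _)) (meets-rest c∈ b≈))
              (minimum _)
          ; (inj₂ b≈) (inj₂ c≈) ne → contradiction (≈-trans b≈ (≈-sym c≈)) ne }
        } inj₁ (inj₂ (≈ⱽ-refl (element underlying rest)))

    antichain-elim : ∀ {p r} → (∀ (a : Elem) q → q ≤ p → q ≤ proj₁ a → q ≤ r) →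
                     p ≤ r
    antichain-elim = ⋁-elim antichain-cover

  open MaximalAntichain using (Elem)
  open FunctionOn

  mixture : ∀ {A} → FunctionOn 𝔹 A → Name 𝔹
  mixture f = mix proj₁ (app f)

  mixture-mixes : ∀ {A} (f : FunctionOn 𝔹 A) → Mixes 𝔹 A f (mixture f)
  mixture-mixes {A} f a = ≤⟦＝⟧ (mix-mixes proj₁ (app f)
    (λ b c → [ inj₁ ∘ FunctionOn.cong f , inj₂ ]′ (antichain-disjoint A b c)) a)

  mixes-at : ∀ {A p} (f : FunctionOn 𝔹 A) τ → Mixes 𝔹 A f τ →
             ∀ a → p ≤ proj₁ a → p ⊩ τ ≃ app f a ˇ
  mixes-at f τ m a p≤a = ≃⟨ ≤-trans p≤a (m a) ⟩

  mixes-unique : ∀ {A σ τ p} {f : FunctionOn 𝔹 A} →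
                 Mixes 𝔹 A f σ → Mixes 𝔹 A f τ → p ⊩ σ ≃ τ
  mixes-unique {A} {σ} {τ} {f = f} m m′ = ≃⟨ antichain-elim A (λ a q _ q≤a →
    ≤⟦＝⟧ (≃-trans (mixes-at f σ m a q≤a)
                   (≃-sym (mixes-at f τ m′ a q≤a)))) ⟩

  module _ {A C : MaximalAntichain 𝔹} (C≤A : _≤*_ 𝔹 C A) where

    project : Elem C → Elem A
    project c = proj₁ (C≤A c)

    -- Distinct members of `A` are incompatible, so they cannot both lie above a nonzero element of
    -- `C`.
    project-cong : ∀ {c c′} → proj₁ c ≈ proj₁ c′ →
                   proj₁ (project c) ≈ proj₁ (project c′)
    project-cong {c} {c′} e =
      [ id , (λ ≤⊥ → contradiction (antisym (≤-trans (∧-greatest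
          (proj₂ (C≤A c)) (≤-trans (reflexive e) (proj₂ (C≤A c′)))) ≤⊥)
          (minimum _))
        (IsAntichain.nonzero (MaximalAntichain.isAntichain C) (proj₂ c))) ]′
      (antichain-disjoint A (project c) (project c′))

    pullback : FunctionOn 𝔹 A → FunctionOn 𝔹 C
    pullback f = record
      { app  = app f ∘ project
      ; cong = λ {c} {c′} e → FunctionOn.cong f {project c} {project c′}
                                (project-cong {c} {c′} e) }

    pullback-mixes : ∀ {f τ} → Mixes 𝔹 A f τ → Mixes 𝔹 C (pullback f) τ
    pullback-mixes m c = ≤-trans (proj₂ (C≤A c)) (m (project c))

-- The quotient `Vᴮ/U` and the Boolean ultrapower inside it.

module BooleanUltrapower
  (em  : ∀ {a : Level} → ExcludedMiddle a)
  (ext : ∀ {a b : Level} → Extensionality a b)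
  {ℓ : Level} (𝔹 : CompleteBooleanAlgebra ℓ) (U : Ultrafilter 𝔹) where

  open CompleteBooleanAlgebra 𝔹
  open Forcing em ext 𝔹
  open FunctionOn
  open MaximalAntichain using (Elem; asSet)
  private module U = Ultrafilter U
  open ∈-Structure (Vᴮ/U 𝔹 U) renaming (_≈ᴹ_ to _~_; _∈ᴹ_ to _E_) using ()

  ~-intro : ∀ {p} σ τ → p ∈ U.member → p ⊩ σ ≃ τ → σ ~ τ
  ~-intro _ _ p∈U h = U.upward (≤⟦＝⟧ h) p∈U

  E-intro : ∀ {p} σ τ → p ∈ U.member → p ⊩ σ ε τ → σ E τ
  E-intro _ _ p∈U h = U.upward (≤⟦∈⟧ h) p∈U

  ~-refl : ∀ σ → σ ~ σ
  ~-refl σ = ~-intro σ σ U.⊤-member ≃-refl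

  ~-sym : ∀ σ τ → σ ~ τ → τ ~ σ
  ~-sym σ τ h = ~-intro τ σ h (≃-sym (forces-≃ σ τ ≤-refl))

  ~-trans : ∀ σ τ ρ → σ ~ τ → τ ~ ρ → σ ~ ρ
  ~-trans σ τ ρ h h′ = ~-intro σ ρ (U.∧-closed h h′)
    (≃-trans (forces-≃ σ τ (x∧y≤x _ _)) (forces-≃ τ ρ (x∧y≤y _ _)))

  E-congˡ : ∀ σ σ′ τ → σ ~ σ′ → σ E τ → σ′ E τ
  E-congˡ σ σ′ τ h h′ = E-intro σ′ τ (U.∧-closed h h′)
    (ε-congˡ (forces-≃ σ σ′ (x∧y≤x _ _)) (forces-ε σ τ (x∧y≤y _ _)))

  E-congʳ : ∀ σ τ τ′ → τ ~ τ′ → σ E τ → σ E τ′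
  E-congʳ σ τ τ′ h h′ = E-intro σ τ′ (U.∧-closed h h′)
    (ε-congʳ (forces-≃ τ τ′ (x∧y≤x _ _)) (forces-ε σ τ (x∧y≤y _ _)))

  ∨-prime : ∀ {b c} → b ∨ c ∈ U.member → b ∈ U.member ⊎ c ∈ U.member
  ∨-prime {b} {c} h with U.ultra b
  ... | inj₁ b∈U  = inj₁ b∈U
  ... | inj₂ ∁b∈U = inj₂ (U.upward
    (∨-elim (x∧y≤x _ _)
      (λ q q≤ q≤b → ⊥-elimᶠ (∁-elim (∧-elimʳ q≤) q≤b))
      (λ q _ → id))
    (U.∧-closed h ∁b∈U))

  -- The join over the class V is the join of the set of its values.
  InV̌-intro : ∀ σ {I : Set ℓ} (x : I → V ℓ) →
              ⋁ (λ i → ⟦_＝_⟧ 𝔹 σ (x i ˇ)) ∈ U.member → InV̌ 𝔹 U σ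
  InV̌-intro σ x h =
    ⋁ {I = Value} proj₁ ,
    ((λ y → ⋁-intro (value y) ≤-refl) ,
     (λ c bound → ⋁-elim ≤-refl λ { (b , ∃y) q _ q≤b →
       let (y , b≡) = toWitness ∃y
       in ≤-trans q≤b (subst (_≤ c) (≡-sym b≡) (bound y)) })) ,
    U.upward (⋁-elim ≤-refl λ i q _ q≤ → ⋁-intro (value (x i)) q≤) h
    where
    Value : Set ℓ
    Value = ∃ λ b → True (em {P = ∃ λ y → b ≡ ⟦_＝_⟧ 𝔹 σ (y ˇ)})

    value : V ℓ → Value
    value y = ⟦_＝_⟧ 𝔹 σ (y ˇ) , fromWitness (y , ≡-refl)

  module _ {I : Set ℓ} {p : I → Carrier} (p∈U : ⋁ p ∈ U.member) where

    InV̌-mixed : ∀ σ (x : I → V ℓ) → (∀ i → p i ⊩ σ ≃ x i ˇ) → InV̌ 𝔹 U σ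
    InV̌-mixed σ x h = InV̌-intro σ x
      (U.upward (⋁-elim ≤-refl λ i q _ q≤pᵢ → ⋁-intro i (≤⟦＝⟧ (≃-weaken q≤pᵢ (h i)))) p∈U)

    -- On each piece the members of the standard pair are explicit, which puts `⟦w ＝ u⟧ ∨ ⟦w ＝ v⟧`
    -- into `U`; primeness of `U` then decides for one side.
    mixed-isUnorderedPair : ∀ {z u v} {x y : I → V ℓ} →
      (∀ i → p i ⊩ proj₁ z ≃ ｛ x i , y i ｝ ˇ) →
      (∀ i → p i ⊩ proj₁ u ≃ x i ˇ) → (∀ i → p i ⊩ proj₁ v ≃ y i ˇ) →
      IsUnorderedPair (V̌ᵤ 𝔹 U) z u v
    mixed-isUnorderedPair {z , _} {u , _} {v , _} {x} {y} z≃ u≃ v≃ (w , _) = mk⇔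
      (λ wEz → ∨-prime (U.upward
        (⋁-elim (x∧y≤x _ _) λ i q q≤ q≤pᵢ →
          ε-ˇ-elim ｛ x i , y i ｝
            (ε-congʳ (≃-weaken q≤pᵢ (z≃ i)) (forces-ε w z (∧-elimʳ q≤)))
            λ { (lift true) r r≤q w≃ → ≤-trans
                  (≤⟦＝⟧ (≃-trans w≃ (≃-sym (≃-weaken (≤-trans r≤q q≤pᵢ) (u≃ i)))))
                  (x≤x∨y _ _)
              ; (lift false) r r≤q w≃ → ≤-trans
                  (≤⟦＝⟧ (≃-trans w≃ (≃-sym (≃-weaken (≤-trans r≤q q≤pᵢ) (v≃ i)))))
                  (y≤x∨y _ _) })
        (U.∧-closed p∈U wEz)))
      [ (λ w~u → member-of u x (λ i → lift true , ≈ⱽ-refl (x i)) u≃ w~u)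
      , (λ w~v → member-of v y (λ i → lift false , ≈ⱽ-refl (y i)) v≃ w~v) ]′
      where
      member-of : ∀ t (a : I → V ℓ) → (∀ i → a i ∈ⱽ ｛ x i , y i ｝) →
                  (∀ i → p i ⊩ t ≃ a i ˇ) → w ~ t → w E z
      member-of t a a∈ t≃ w~t = E-intro w z (U.∧-closed p∈U w~t)
        ε⟨ ⋁-elim (x∧y≤x _ _) (λ i q q≤ q≤pᵢ → ≤⟦∈⟧
          (ε-congʳ (≃-sym (≃-weaken q≤pᵢ (z≃ i)))
            (ε-ˇ-intro (a i) ｛ x i , y i ｝ (a∈ i)
              (≃-trans (forces-≃ w t (∧-elimʳ q≤)) (≃-weaken q≤pᵢ (t≃ i)))))) ⟩

  -- The generic filter and values at its elements.

  private
    el : Carrier → V ℓ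
    el = element underlying

  -- Together with `ε-Ġ-elim` this computes the Boolean value of a standard `b` lying in `Ġ` as `b`
  -- itself.
  ε-Ġ-intro : ∀ {p σ} b → p ≤ b → p ⊩ σ ≃ el b ˇ → p ⊩ σ ε Ġ 𝔹
  ε-Ġ-intro b h e = ε-intro {τ = λ b → el b ˇ} {c = id} b h e

  ε-Ġ-elim : ∀ {p σ} b → p ⊩ σ ε Ġ 𝔹 → p ⊩ σ ≃ el b ˇ → p ≤ b
  ε-Ġ-elim b h e = ε-elim h λ c q q≤p q≤c e′ →
    ≃-absolute (el c) (el b) (≃-trans (≃-sym e′) (≃-weaken q≤p e)) λ c≈b →
      ≤-trans q≤c (reflexive c≈b)

  -- z determines an element of A on each piece ⟦z = (a, f a)ˇ⟧; mixing over
  -- these pieces gives a second decomposition of z as an ordered pair.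
  value-at-generic : ∀ {A f y} → IsValueAtGeneric 𝔹 U A f y →
                     proj₁ y ~ mixture f
  value-at-generic {A} {f} {y} (b , _ , bEĠ , z , z-pair , zEf) =
    ~-intro (proj₁ y) (mixture f) (U.∧-closed (U.∧-closed bEĠ (proj₁ b~,y~)) (U.∧-closed zEf (proj₂ b~,y~)))
      ≃⟨ ⋁-elim (≤-trans (∧-elimˡ (x∧y≤y _ _))
           (⋁-elim ≤-refl λ a q _ q≤ → ⋁-intro a (∧-elimʳ q≤))) (λ a q q≤ q≤pₐ →
         -- On the piece `p a` the name `b` is the standard name of `a`; as `b` is generic, the
         -- condition lies below `a`, where `mixture f` has the value `app f a`.
         let q≤a = ε-Ġ-elim (proj₁ a) (forces-ε (proj₁ b) (Ġ 𝔹) (∧-elimˡ (∧-elimˡ q≤)))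
                     (≃-trans (forces-≃ (proj₁ b) (mix p point) (∧-elimʳ (∧-elimˡ q≤)))
                              (≃-weaken q≤pₐ (mixed point (λ _ _ → id) a)))
         in ≤⟦＝⟧ (≃-trans (forces-≃ (proj₁ y) (mix p (app f)) (∧-elimʳ (∧-elimʳ q≤)))
              (≃-trans (≃-weaken q≤pₐ (mixed (app f) app-cong a))
                (≃-sym (mixes-at f (mixture f) (mixture-mixes f) a q≤a))))) ⟩
    where
    point : Elem A → V ℓ
    point a = el (proj₁ a)

    p : Elem A → Carrier
    p a = ⟦_＝_⟧ 𝔹 (proj₁ z) (⟨ point a , app f a ⟩ ˇ)

    p∈U : ⋁ p ∈ U.member
    p∈U = U.upward (⋁-elim ≤-refl λ a q _ q≤ → ⋁-intro a (∧-elimʳ q≤)) zEf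

    app-cong : ∀ a a′ → point a ≈ⱽ point a′ → app f a ≈ⱽ app f a′
    app-cong _ _ = FunctionOn.cong f

    mixed : (F : Elem A → V ℓ) →
            (∀ a a′ → point a ≈ⱽ point a′ → F a ≈ⱽ F a′) →
            ∀ a → p a ⊩ mix p F ≃ F a ˇ
    mixed F F-cong = mix-mixes p F λ a a′ → compatible a a′ em
      where
      compatible : ∀ a a′ → Dec (p a ∧ p a′ ≤ ⊥) → F a ≈ⱽ F a′ ⊎ p a ∧ p a′ ≤ ⊥
      compatible a a′ (yes ≤⊥) = inj₂ ≤⊥
      -- Two pieces that meet make two standard pairs equal, hence their first components, on which
      -- alone `F` depends.
      compatible a a′ (no ≰⊥)  = inj₁ (F-cong a a′
        (⟨⟩-injectiveˡ (point a) (app f a) (point a′) (app f a′)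
          (≃⇒≈ ⟨ point a , app f a ⟩ ⟨ point a′ , app f a′ ⟩ ≰⊥
            (≃-trans (≃-sym (forces-≃ (proj₁ z) (⟨ point a , app f a ⟩ ˇ) (x∧y≤x _ _)))
                     (forces-≃ (proj₁ z) (⟨ point a′ , app f a′ ⟩ ˇ) (x∧y≤y _ _))))))

    ｛｝-cong : ∀ x x′ y y′ → x ≈ⱽ x′ → y ≈ⱽ y′ → ｛ x , y ｝ ≈ⱽ ｛ x′ , y′ ｝
    ｛｝-cong x x′ y y′ e e′ =
      (λ { (lift true) → lift true , e ; (lift false) → lift false , e′ }) ,
      (λ { (lift true) → lift true , e ; (lift false) → lift false , e′ })

    F₁ F₂ : Elem A → V ℓ
    F₁ a = ｛ point a , point a ｝
    F₂ a = ｛ point a , app f a ｝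

    F₁-cong : ∀ a a′ → point a ≈ⱽ point a′ → F₁ a ≈ⱽ F₁ a′
    F₁-cong a a′ e = ｛｝-cong (point a) (point a′) (point a) (point a′) e e

    F₂-cong : ∀ a a′ → point a ≈ⱽ point a′ → F₂ a ≈ⱽ F₂ a′
    F₂-cong a a′ e = ｛｝-cong (point a) (point a′) (app f a) (app f a′) e (app-cong a a′ e)

    mixedᵤ : (F : Elem A → V ℓ) →
             (∀ a a′ → point a ≈ⱽ point a′ → F a ≈ⱽ F a′) → Σ (Name 𝔹) (InV̌ 𝔹 U)
    mixedᵤ F F-cong = mix p F , InV̌-mixed p∈U (mix p F) F (mixed F F-cong)

    mixed-pair : IsOrderedPair (V̌ᵤ 𝔹 U) z (mixedᵤ point λ _ _ → id) (mixedᵤ (app f) app-cong)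
    mixed-pair =
      let pointᵤ = mixedᵤ point λ _ _ → id
          valueᵤ = mixedᵤ (app f) app-cong
          s      = mixedᵤ F₁ F₁-cong
          t      = mixedᵤ F₂ F₂-cong
      in
      s , t ,
      mixed-isUnorderedPair p∈U {s} {pointᵤ} {pointᵤ} (mixed F₁ F₁-cong)
        (mixed point λ _ _ → id) (mixed point λ _ _ → id) ,
      mixed-isUnorderedPair p∈U {t} {pointᵤ} {valueᵤ} (mixed F₂ F₂-cong)
        (mixed point λ _ _ → id) (mixed (app f) app-cong) ,
      mixed-isUnorderedPair p∈U {z} {s} {t} {F₁} {F₂}
        (λ a → forces-≃ (proj₁ z) (⟨ point a , app f a ⟩ ˇ) ≤-refl)
        (mixed F₁ F₁-cong) (mixed F₂ F₂-cong)

    open OrderedPairs (V̌ᵤ 𝔹 U)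
      (λ {σ} {τ} → ~-sym (proj₁ σ) (proj₁ τ))
      (λ {σ} → ~-refl (proj₁ σ))
      (λ {σ} {τ} {ρ} → ~-trans (proj₁ σ) (proj₁ τ) (proj₁ ρ))
      (λ {σ} {τ} {τ′} → E-congʳ (proj₁ σ) (proj₁ τ) (proj₁ τ′))

    b~,y~ : proj₁ b ~ mix p point × proj₁ y ~ mix p (app f)
    b~,y~ = IsOrderedPair-injective {z} {b} {y} {mixedᵤ point λ _ _ → id}
      {mixedᵤ (app f) app-cong} z-pair mixed-pair

  -- For this set `PullbackCoded` at an antichain is `IsSimple` by definition.
  Ġ-part : SubsetOfV̌ᵤ 𝔹 U
  Ġ-part = record
    { member = _E Ġ 𝔹
    ; resp   = λ {σ} {τ} → E-congˡ σ τ (Ġ 𝔹)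
    ; ⊆V̌ᵤ    = λ {σ} σEĠ → InV̌-intro σ el
        (U.upward (⋁-elim ≤-refl λ b q _ q≤ → ⋁-intro b (∧-elimʳ q≤)) σEĠ)
    }

  Ġ-coded : CodedInVᴮ/U 𝔹 U Ġ-part
  Ġ-coded = Ġ 𝔹 , λ _ → mk⇔ id id

  -- Restricting the code to those z for which ⟦ž ∈ c⟧ is nonzero makes it a set,
  -- and is harmless because ⊥ is not generic.
  simple⇒pullback-coded : ∀ {A} → IsSimple 𝔹 U A → ∀ c →
                          Coded (Ult 𝔹 U A) (π⁻¹ 𝔹 U A (_E c))
  simple⇒pullback-coded {A} (h , h-codes) c@(name J ρ d) = code , λ g → mk⇔
    (λ { (τ , m , τEc) → U.upward
      (⋁-elim (x∧y≤x _ _) λ { (a , e∈h) q q≤ q≤a → nonzero-or-⊥ λ q≰⊥ →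
        ⋁-intro (a , nonempty g a (λ v≤⊥ → q≰⊥ (≤-trans
          (≤⟦∈⟧ (ε-congˡ (mixes-at g τ m a q≤a) (forces-ε τ c (∧-elimʳ q≤)))) v≤⊥))
          e∈h) q≤a })
      (U.∧-closed (large g τ m τEc) τEc) })
    (λ L → mixture g , mixture-mixes g , from-large g L)
    where
    value : V ℓ → Carrier
    value z = ⟦_∈_⟧ 𝔹 (z ˇ) c

    value-cong : ∀ x y → x ≈ⱽ y → value x ≈ value y
    value-cong x y x≈y = antisym
      (≤⟦∈⟧ (ε-congˡ (≈⇒≃ x y x≈y) (forces-ε (x ˇ) c ≤-refl)))
      (≤⟦∈⟧ (ε-congˡ (≈⇒≃ y x (≈ⱽ-sym x y x≈y)) (forces-ε (y ˇ) c ≤-refl)))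

    -- One `z` is kept for each `j` and each attained value `⟦ž ＝ ρ j⟧`, which cuts the class of all
    -- `z` down to a set.
    Witness : Set ℓ
    Witness = ∃ λ ((j , b) : J × Carrier) →
              True (em {P = ∃ λ z → b ≡ ⟦_＝_⟧ 𝔹 (z ˇ) (ρ j)})

    witness : Witness → V ℓ
    witness (_ , w) = proj₁ (toWitness w)

    -- The `z` given and the one kept for its value both equal `ρ j` on a common nonzero condition,
    -- so absoluteness identifies them.
    witnessed : ∀ z → ¬ value z ≤ ⊥ → ∃[ w ] z ≈ⱽ witness w
    witnessed z v≰⊥ =
      let (j , n) = nonzero-witness v≰⊥ ≤-refl
          found   = fromWitness (z , ≡-refl)
          w       = (j , ⟦_＝_⟧ 𝔹 (z ˇ) (ρ j)) , found
      in w , ≃⇒≈ z (witness w) n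
        (≃-trans (forces-≃ (z ˇ) (ρ j) (∧-elimʳ (x∧y≤y _ _)))
          (≃-sym (forces-≃ (witness w ˇ) (ρ j)
            (subst (λ b → value z ∧ d j ∧ ⟦_＝_⟧ 𝔹 (z ˇ) (ρ j) ≤ b)
              (proj₂ (toWitness found)) (∧-elimʳ (x∧y≤y _ _))))))

    code : FunctionOn 𝔹 A
    code = record
      { app  = λ a → sup (∃ λ w → el (value (witness w)) ∈ⱽ app h a) (witness ∘ proj₁)
      ; cong = λ {a} {a′} a≈a′ →
          (λ (w , v∈) → (w , ∈ⱽ-congʳ _ (app h a) (app h a′)
            (FunctionOn.cong h a≈a′) v∈) , ≈ⱽ-refl (witness w)) ,
          (λ (w , v∈) → (w , ∈ⱽ-congʳ _ (app h a′) (app h a)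
            (≈ⱽ-sym (app h a) (app h a′) (FunctionOn.cong h a≈a′)) v∈) ,
            ≈ⱽ-refl (witness w))
      }

    -- The mixture of these Boolean values is forced into `Ġ` by exactly the conditions forcing
    -- `mixture g` into `c`; this ties `c` to G_A.
    values : FunctionOn 𝔹 A → FunctionOn 𝔹 A
    values g = record
      { app  = λ a → el (value (app g a))
      ; cong = λ {a} {a′} a≈a′ → value-cong (app g a) (app g a′) (FunctionOn.cong g a≈a′)
      }

    module _ (g : FunctionOn 𝔹 A) where

      nonempty : ∀ a → ¬ value (app g a) ≤ ⊥ →
                 app (values g) a ∈ⱽ app h a → app g a ∈ⱽ app code a
      nonempty a v≰⊥ e∈h =
        let (w , e) = witnessed (app g a) v≰⊥
        in (w , ∈ⱽ-congˡ (el (value (app g a))) (el (value (witness w))) (app h a)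
                  (value-cong (app g a) (witness w) e) e∈h) , e

      large : ∀ τ → Mixes 𝔹 A g τ → τ E c →
              Large 𝔹 U A (λ a → app (values g) a ∈ⱽ app h a)
      large τ m τEc = to (h-codes (values g))
        ( mixture (values g) , mixture-mixes (values g)
        , E-intro (mixture (values g)) (Ġ 𝔹) τEc
          ε⟨ antichain-elim A (λ a q q≤ q≤a → ≤⟦∈⟧ (ε-Ġ-intro (value (app g a))
            (≤⟦∈⟧ (ε-congˡ (mixes-at g τ m a q≤a) (forces-ε τ c q≤)))
            (mixes-at (values g) (mixture (values g)) (mixture-mixes (values g)) a q≤a))) ⟩ )

      from-large : Large 𝔹 U A (λ a → app g a ∈ⱽ app code a) → mixture g E c
      from-large L =
        let (τ , m , τEĠ) = from (h-codes (values g)) (U.upward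
              (⋁-elim ≤-refl λ { (a , ((w , v∈h) , e)) q _ q≤a →
                ⋁-intro (a , ∈ⱽ-congˡ (el (value (witness w))) (el (value (app g a))) (app h a)
                  (value-cong (witness w) (app g a) (≈ⱽ-sym (app g a) (witness w) e)) v∈h) q≤a })
              L)
        in E-intro (mixture g) c τEĠ ε⟨ antichain-elim A (λ a q q≤ q≤a → ≤⟦∈⟧
             (ε-congˡ (≃-sym (mixes-at g (mixture g) (mixture-mixes g) a q≤a))
               (forces-ε (app g a ˇ) c (ε-Ġ-elim (value (app g a)) (forces-ε τ (Ġ 𝔹) q≤)
                    (mixes-at (values g) τ m a q≤a))))) ⟩

  coded⇒pullback-coded : ∀ {A} (x : SubsetOfV̌ᵤ 𝔹 U) → IsSimple 𝔹 U A →
                         CodedInVᴮ/U 𝔹 U x → PullbackCoded 𝔹 U A x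
  coded⇒pullback-coded x simple (c , c-codes) =
    let (k , k-codes) = simple⇒pullback-coded simple c
    in k , λ g → mk⇔
         (λ (τ , m , τ∈x) → to (k-codes g) (τ , m , to (c-codes τ) τ∈x))
         (λ g∈k → let (τ , m , τEc) = from (k-codes g) g∈k
                  in τ , m , from (c-codes τ) τEc)

-- Quantification over a skeleton inside `Vᴮ/U`.

module SkeletonTheory
  (em  : ∀ {a : Level} → ExcludedMiddle a)
  (ext : ∀ {a b : Level} → Extensionality a b)
  {ℓ : Level} (𝔹 : CompleteBooleanAlgebra ℓ) (U : Ultrafilter 𝔹)
  (𝔄 : Skeleton 𝔹 U) where

  open CompleteBooleanAlgebra 𝔹
  open Forcing em ext 𝔹
  open BooleanUltrapower em ext 𝔹 U
  open FunctionOn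
  open MaximalAntichain using (Elem; asSet)
  open Skeleton 𝔄
  private module U = Ultrafilter U
  open ∈-Structure (Vᴮ/U 𝔹 U) renaming (_≈ᴹ_ to _~_; _∈ᴹ_ to _E_) using ()

  family : Idx → V ℓ
  family i = asSet (antichain i)

  -- A code for j[𝔄].
  𝔞 : Name 𝔹
  𝔞 = proj₁ j[]-coded

  -- These values are known to lie in `U`, not to be `⊤`, so every quantifier over j[𝔄] carries them
  -- as guards.
  chosen : Idx → Carrier
  chosen i = ⟦_∈_⟧ 𝔹 (family i ˇ) 𝔞

  chosen-∈U : ∀ i → chosen i ∈ U.member
  chosen-∈U i = to (proj₂ j[]-coded (family i ˇ)) (i , ~-refl (family i ˇ))

  -- Łoś's theorem for quantification over members of j[𝔄]: a name for some
  -- Ǎᵢ in 𝔞 with φ is obtained by mixing along a disjoint refinement, and since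
  -- 𝔞 has standard members only, the mixture is equivalent to a single Ǎᵢ.
  module _ {K : Set ℓ} (h : K → Idx) (φ : K → Carrier)
           (φ-resp : ∀ k l → family (h k) ≈ⱽ family (h l) → φ k ≤ φ l) where

    łoś-∃ : ⋁ (λ k → chosen (h k) ∧ φ k) ∈ U.member → ∃[ k ] φ k ∈ U.member
    łoś-∃ ⋁∈U = result em
      where
      disjointified : ∃[ d ] (∀ k → d k ≤ chosen (h k) ∧ φ k) ×
                      (∀ k l → k ≡ l ⊎ d k ∧ d l ≤ ⊥) ×
                      ⋁ (λ k → chosen (h k) ∧ φ k) ≤ ⋁ d
      disjointified = disjointify λ k → chosen (h k) ∧ φ k

      d = proj₁ disjointified
      d≤ = proj₁ (proj₂ disjointified)
      ⋁d∈U = U.upward (proj₂ (proj₂ (proj₂ disjointified))) ⋁∈U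

      σ : Name 𝔹
      σ = mix d (family ∘ h)

      σ≃ : ∀ k → d k ⊩ σ ≃ family (h k) ˇ
      σ≃ = mix-mixes d (family ∘ h) λ k l →
        [ (λ { ≡-refl → inj₁ (≈ⱽ-refl (family (h k))) }) , inj₂ ]′
        (proj₁ (proj₂ (proj₂ disjointified)) k l)

      standard : ∃[ i ] σ ~ family i ˇ
      standard = from (proj₂ j[]-coded σ) (E-intro σ 𝔞 ⋁d∈U ε⟨ ⋁-elim ≤-refl (λ k q _ q≤d →
        ≤⟦∈⟧ (ε-congˡ (≃-sym (≃-weaken q≤d (σ≃ k)))
          (forces-ε (family (h k) ˇ) 𝔞 (∧-elimˡ (≤-trans q≤d (d≤ k)))))) ⟩)

      i = proj₁ standard

      Hit : Set ℓ
      Hit = ∃[ k ] family (h k) ≈ⱽ family i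

      -- Where `σ` equals the standard `family i`, absoluteness leaves only pieces `d k` with
      -- `family (h k) ≈ⱽ family i`.
      by-hits : ∀ {r} → (∀ k q → q ≤ φ k → family (h k) ≈ⱽ family i → q ≤ r) →
                ⟦_＝_⟧ 𝔹 σ (family i ˇ) ∧ ⋁ d ≤ r
      by-hits f = ⋁-elim (x∧y≤y _ _) λ k q q≤ q≤d →
        ≃-absolute (family (h k)) (family i)
          (≃-trans (≃-sym (≃-weaken q≤d (σ≃ k))) (forces-≃ σ (family i ˇ) (∧-elimˡ q≤)))
          (f k q (∧-elimʳ (≤-trans q≤d (d≤ k))))

      both : ⟦_＝_⟧ 𝔹 σ (family i ˇ) ∧ ⋁ d ∈ U.member
      both = U.∧-closed (proj₂ standard) ⋁d∈U

      result : Dec Hit → ∃[ k ] φ k ∈ U.member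
      result (no none) = contradiction
        (U.upward (by-hits λ k q _ e → contradiction (k , e) none) both) U.⊥-∉
      result (yes (k , e)) = k , U.upward
        (by-hits λ l q q≤φ e′ → ≤-trans q≤φ (φ-resp l k
          (≈ⱽ-trans (family (h l)) (family i) (family (h k)) e′
            (≈ⱽ-sym (family (h k)) (family i) e)))) both

  -- Dual to `łoś-∃`: if the join of the guarded counterexamples were in `U`, a single `∁ φ k` would
  -- be in `U` too.
  łoś-∀ : ∀ {K : Set ℓ} (h : K → Idx) (φ : K → Carrier) →
          (∀ k l → family (h k) ≈ⱽ family (h l) → φ k ≤ φ l) →
          (∀ k → φ k ∈ U.member) → ⋀ (λ k → chosen (h k) ⇨ φ k) ∈ U.member
  łoś-∀ h φ φ-resp φ∈U with U.ultra (⋁ λ k → chosen (h k) ∧ ∁ φ k)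
  ... | inj₂ none = U.upward
    (⋀-intro λ k → ⇨-intro λ q q≤ q≤c → byCases (φ k) (λ _ _ → id) λ r r≤q r≤∁ →
      ⊥-elimᶠ (∁-elim (≤-trans r≤q q≤)
        (⋁-intro k (∧-greatest (≤-trans r≤q q≤c) r≤∁))))
    none
  ... | inj₁ some =
    let (k , ∁φ∈U) = łoś-∃ h (∁_ ∘ φ)
          (λ k l e → ∁-intro λ q q≤∁ q≤φ → ∁-elim q≤∁ (≤-trans q≤φ (φ-resp l k
            (≈ⱽ-sym (family (h k)) (family (h l)) e)))) some
    in contradiction
         (U.upward (∁-elim (x∧y≤y _ _) (x∧y≤x _ _)) (U.∧-closed (φ∈U k) ∁φ∈U)) U.⊥-∉

  -- Codes are chosen for indices, but łoś-∃ and łoś-∀ need them to depend on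
  -- the antichain only; so every index is replaced by a representative.
  private
    pick : (P : Idx → Bool) → ∃ (T ∘ P) → Dec (∃ (T ∘ P)) → ∃ (T ∘ P)
    pick P w (yes v) = v
    pick P w (no ¬w) = contradiction w ¬w

    -- The supplied witness serves only to refute a negative decision; the result is whatever `em`
    -- returns for the predicate.
    pick-constant : ∀ {P Q} → P ≡ Q → ∀ w w′ → proj₁ (pick P w em) ≡ proj₁ (pick Q w′ em)
    pick-constant {P} ≡-refl w w′ = constant em
      where
      constant : ∀ d → proj₁ (pick P w d) ≡ proj₁ (pick P w′ d)
      constant (yes _) = ≡-refl
      constant (no ¬w) = contradiction w ¬w

    -- Bool-valued, so that indices of equal antichains give equal predicates.
    same : Idx → Idx → Bool
    same i k = isYes (em {P = family k ≈ⱽ family i})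

    self : ∀ i → ∃ (T ∘ same i)
    self i = i , fromWitness (≈ⱽ-refl (family i))

  rep : Idx → Idx
  rep i = proj₁ (pick (same i) (self i) em)

  rep-same : ∀ i → family (rep i) ≈ⱽ family i
  rep-same i = toWitness (proj₂ (pick (same i) (self i) em))

  rep-cong : ∀ {i j} → family i ≈ⱽ family j → rep i ≡ rep j
  rep-cong {i} {j} e = pick-constant
    (⊑-antisym (λ k k~i → fromWitness
                  (≈ⱽ-trans (family k) (family i) (family j) (toWitness k~i) e))
               (λ k k~j → fromWitness
                  (≈ⱽ-trans (family k) (family j) (family i) (toWitness k~j)
                    (≈ⱽ-sym (family i) (family j) e))))
    (self i) (self j)
    where open WellOrdering em ext Idx using (⊑-antisym)

  infix 4 _⊴_
  _⊴_ : MaximalAntichain 𝔹 → MaximalAntichain 𝔹 → Set ℓ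
  _⊴_ = _≤*_ 𝔹

  ⊴-trans : ∀ {A B C} → A ⊴ B → B ⊴ C → A ⊴ C
  ⊴-trans A⊴B B⊴C a =
    let (b , a≤b) = A⊴B a ; (c , b≤c) = B⊴C b in c , ≤-trans a≤b b≤c

  rep-⊴ : ∀ i → antichain (rep i) ⊴ antichain i
  rep-⊴ i a = let (b , e) = proj₁ (rep-same i) a in b , reflexive e

  R : Idx → MaximalAntichain 𝔹
  R i = antichain (rep i)

  directed-R : ∀ i j → ∃[ k ] (R k ⊴ R i) × (R k ⊴ R j)
  directed-R i j =
    let (k , k⊴i , k⊴j) = directed (rep i) (rep j)
    in k , ⊴-trans {R k} {antichain k} {R i} (rep-⊴ k) k⊴i
         , ⊴-trans {R k} {antichain k} {R j} (rep-⊴ k) k⊴j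

  generates-R : ∀ σ → InV̌ 𝔹 U σ → ∃[ i ] Σ (FunctionOn 𝔹 (R i)) λ g → σ ~ mixture g
  generates-R σ σ∈V̌ =
    let (i , f , v) = generates (σ , σ∈V̌)
        f↓          = pullback (rep-⊴ i) f
    in i , f↓ , ~-trans σ (mixture f) (mixture f↓)
         (value-at-generic {antichain i} {f} {σ , σ∈V̌} v)
         (~-intro (mixture f) (mixture f↓) U.⊤-member
           (mixes-unique {f = f↓} (pullback-mixes {C = R i} (rep-⊴ i) {f} {mixture f} (mixture-mixes f))
                                  (mixture-mixes f↓)))

  -- Assembling a code for x from codes for its pullbacks.

  module _ (x : SubsetOfV̌ᵤ 𝔹 U)
           (codes : ∀ i → PullbackCoded 𝔹 U (antichain i) x) where
    private module x = SubsetOfV̌ᵤ x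

    codeAt : ∀ j → FunctionOn 𝔹 (antichain j)
    codeAt j = proj₁ (codes j)

    code : ∀ i → FunctionOn 𝔹 (R i)
    code i = codeAt (rep i)

    -- ⟦ž ∈ y_C⟧
    inValueAt : Idx → V ℓ → Carrier
    inValueAt j z = ⋁ {I = Σ (Elem (antichain j)) λ a → z ∈ⱽ app (codeAt j) a} (proj₁ ∘ proj₁)

    Refining : MaximalAntichain 𝔹 → Set ℓ
    Refining A = ∃[ C ] R C ⊴ A

    -- ⟦ž ∈ ⋂_{C ≤* A} y_C⟧
    eventually : MaximalAntichain 𝔹 → V ℓ → Carrier
    eventually A z = ⋀ {I = Refining A} λ (C , _) → chosen C ⇨ inValueAt (rep C) z

    -- ⟦ž ∈ ⋃_B ⋂_{C ≤* B} y_C⟧, with B ranging over `𝔞`.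
    limit : V ℓ → Carrier
    limit z = ⋁ λ B → chosen B ∧ eventually (R B) z

    Support : Set ℓ
    Support = Σ Idx λ i → Σ (Elem (R i)) λ a → Index (app (code i) a)

    point : Support → V ℓ
    point (i , a , m) = element (app (code i) a) m

    𝔠 : Name 𝔹
    𝔠 = name Support (λ k → point k ˇ) (limit ∘ point)

    module _ {i} (g : FunctionOn 𝔹 (R i)) where

      -- ⟦τ ∈ y_C⟧ for τ = j(g)(b_A); the refinement projection is left
      -- existential so that the value does not depend on a proof of C ≤* A.
      agreesAt : Idx → Carrier
      agreesAt j = ⋁ {I = Σ (Elem (antichain j)) λ c → ∃[ a ] proj₁ c ≤ proj₁ a ×
                          app g a ∈ⱽ app (codeAt j) c} (proj₁ ∘ proj₁)

      -- At each refining C the pullback of `g` belongs to the coded set; `łoś-∀` merges these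
      -- separate facts into one element of `U`.
      agreement : mixture g ∈ x.member →
                  ⋀ {I = Refining (R i)} (λ (C , _) → chosen C ⇨ agreesAt (rep C)) ∈ U.member
      agreement τ∈x = łoś-∀ proj₁ (λ (C , _) → agreesAt (rep C))
        (λ (C , _) (D , _) e → subst (λ j → agreesAt (rep C) ≤ agreesAt j) (rep-cong e) ≤-refl)
        λ (C , C⊴) → U.upward
          (⋁-elim ≤-refl λ { (c , g∈) q _ q≤c →
            ⋁-intro (c , project {R i} {R C} C⊴ c , proj₂ (C⊴ c) , g∈) q≤c })
          (to (proj₂ (codes (rep C)) (pullback C⊴ g))
            (mixture g , pullback-mixes {C = R C} C⊴ {g} {mixture g} (mixture-mixes g) , τ∈x))

      -- The union is entered at B = `R i`. Below `a`, a nonzero condition under `c` makes the `a′`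
      -- above `c` equal to `a`, so agreement about `g` becomes membership of `z`.
      agreement⇒limit : ∀ {q} a z → app g a ≈ⱽ z → q ≤ proj₁ a → q ≤ chosen i →
        q ≤ ⋀ {I = Refining (R i)} (λ (C , _) → chosen C ⇨ agreesAt (rep C)) →
        q ≤ limit z
      agreement⇒limit a z ga≈z q≤a q≤s q≤N = ⋁-intro i (∧-greatest q≤s
        (⋀-intro λ (C , C⊴) → ⇨-intro λ r r≤q r≤s →
          ⋁-elim (⇨-elim (≤-trans r≤q (⋀-elim q≤N (C , C⊴))) r≤s)
            λ { (c , a′ , c≤a′ , ga′∈) t t≤r t≤c →
              antichain-overlap (R i) a a′
                (≤-trans t≤r (≤-trans r≤q q≤a)) (≤-trans t≤c c≤a′)
                λ a≈a′ → ⋁-intro (c , ∈ⱽ-congˡ (app g a′) z (app (code C) c)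
                  (≈ⱽ-trans (app g a′) (app g a) z
                    (≈ⱽ-sym (app g a) (app g a′) (FunctionOn.cong g a≈a′)) ga≈z)
                  ga′∈) t≤c }))

    member⇒E : ∀ σ → σ ∈ x.member → σ E 𝔠
    member⇒E σ σ∈x =
      let (i , g , σ~τ) = generates-R σ (x.⊆V̌ᵤ σ∈x)
      in E-congˡ (mixture g) σ 𝔠 (~-sym σ (mixture g) σ~τ)
           (E-intro (mixture g) 𝔠
             (U.∧-closed (agreement g (x.resp σ~τ σ∈x)) (chosen-∈U i))
             ε⟨ ⋁-elim
               -- `R i` refines itself, so agreement at C = `R i` places the values of `g` among the
               -- members of `code i` and thus supplies the index in `Support`.
               (⇨-elim (⋀-elim (x∧y≤x _ _) (i , λ a → a , ≤-refl)) (x∧y≤y _ _))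
               (λ { (c , a , c≤a , (m , ga≈)) q q≤ q≤c →
                 let k   = i , c , m
                     q≤a = ≤-trans q≤c c≤a
                 in ≤⟦∈⟧ (ε-intro {τ = λ k → point k ˇ} {c = limit ∘ point} k
                      (agreement⇒limit g a (point k) ga≈ q≤a (∧-elimʳ q≤) (∧-elimˡ q≤))
                      (≃-trans (mixes-at g (mixture g) (mixture-mixes g) a q≤a)
                        (≈⇒≃ (app g a) (point k) ga≈))) }) ⟩)

    E⇒member : ∀ σ → σ E 𝔠 → σ ∈ x.member
    E⇒member σ σE𝔠 =
      let σ∈V̌           = InV̌-intro σ point
                            (U.upward (⋁-elim ≤-refl λ k q _ q≤ → ⋁-intro k (∧-elimʳ q≤)) σE𝔠)
          (i , g , σ~τ) = generates-R σ σ∈V̌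
      in x.resp (~-sym σ (mixture g) σ~τ)
           (in-limit g (E-congˡ σ (mixture g) 𝔠 σ~τ σE𝔠))
      where
      -- `łoś-∃` fixes a single B of the union. At a common refinement D of `R i` and B, the
      -- intersection puts the value of `g` into `code D`, which codes the pullback of x.
      in-limit : ∀ {i} (g : FunctionOn 𝔹 (R i)) → mixture g E 𝔠 → mixture g ∈ x.member
      in-limit {i} g τE𝔠 =
        let (B , B∈U)      = łoś-∃ id (Φ ∘ rep)
              (λ C D e → subst (λ j → Φ (rep C) ≤ Φ j) (rep-cong e) ≤-refl)
              (U.upward (⋁-elim ≤-refl λ k q _ q≤ → ⋁-elim (∧-elimˡ q≤) λ B r r≤q r≤ →
                ⋁-intro B (∧-greatest (∧-elimˡ r≤) (⋁-intro k
                  (∧-greatest (∧-elimʳ r≤) (≤-trans r≤q (∧-elimʳ q≤)))))) τE𝔠)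
            (D , D⊴i , D⊴B) = directed-R i B
            g↓              = pullback D⊴i g
            (τ′ , m , τ′∈x) = from (proj₂ (codes (rep D)) g↓)
              (U.upward (⋁-elim (x∧y≤x _ _) λ k q q≤ q≤Φ →
                ⋁-elim (⇨-elim (⋀-elim (∧-elimˡ q≤Φ) (D , D⊴B)) (∧-elimʳ q≤))
                  λ { (d , z∈) r r≤q r≤d →
                    ≃-absolute (point k) (app g↓ d)
                      (≃-trans (≃-sym (forces-≃ (mixture g) (point k ˇ)
                                        (≤-trans r≤q (∧-elimʳ q≤Φ))))
                        (mixes-at g↓ (mixture g)
                          (pullback-mixes {C = R D} D⊴i {g} {mixture g} (mixture-mixes g)) d r≤d))
                      λ e → ⋁-intro (d , ∈ⱽ-congˡ (point k) (app g↓ d) (app (code D) d) e z∈)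
                                    r≤d })
                (U.∧-closed B∈U (chosen-∈U D)))
        in x.resp (~-intro τ′ (mixture g) U.⊤-member
             (mixes-unique {f = g↓} m (pullback-mixes {C = R D} D⊴i {g} {mixture g} (mixture-mixes g))))
             τ′∈x
        where
        Φ : Idx → Carrier
        Φ j = ⋁ λ k → eventually (antichain j) (point k) ∧ ⟦_＝_⟧ 𝔹 (mixture g) (point k ˇ)

    pullbacks-coded⇒coded : CodedInVᴮ/U 𝔹 U x
    pullbacks-coded⇒coded = 𝔠 , λ σ → mk⇔ (member⇒E σ) (E⇒member σ)

theorem3p12 : (∀ {a : Level} → ExcludedMiddle a) →
    (∀ {a b : Level} → Extensionality a b) →
    ∀ {ℓ : Level} (𝔹 : CompleteBooleanAlgebra ℓ) (U : Ultrafilter 𝔹) (𝔄 : Skeleton 𝔹 U) →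
    let open Skeleton 𝔄 in
    (⋂ Idx (λ i → PullbackCoded 𝔹 U (antichain i)) ⊆ CodedInVᴮ/U 𝔹 U)
    × ((CodedInVᴮ/U 𝔹 U ⊆ ⋂ Idx (λ i → PullbackCoded 𝔹 U (antichain i))) ⇔ IsSimpleSkeleton 𝔹 U 𝔄)
    × ((∀ (A : MaximalAntichain 𝔹) → IsSimple 𝔹 U A) →
    ⋂ (MaximalAntichain 𝔹) (PullbackCoded 𝔹 U) ≐ CodedInVᴮ/U 𝔹 U)
theorem3p12 em ext 𝔹 U 𝔄 =
    (λ {x} → pullbacks-coded⇒coded x)
  , mk⇔ (λ converse i → converse {Ġ-part} Ġ-coded i)
        (λ simple {x} coded i → coded⇒pullback-coded x (simple i) coded)
  , λ all-simple →
      -- Pullbacks along all maximal antichains include those along the skeleton.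
      (λ {x} pullbacks-coded → pullbacks-coded⇒coded x (pullbacks-coded ∘ antichain))
    , (λ {x} coded A → coded⇒pullback-coded x (all-simple A) coded)
  where
  open Skeleton 𝔄
  open BooleanUltrapower em ext 𝔹 U
  open SkeletonTheory em ext 𝔹 U 𝔄
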